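{- Let $c\ge 1$ be an integer and suppose that $q$ is a prime power, $c<q-1$ and $c$ divides $q-1$. Then $$P\left(\frac{q^2-1}{c}+1,\; q,\; c+1\right)\ \ge\ \frac{q^2-1}{c}+\left\lfloor\frac{q+1}{c}\right\rfloor .$$
   Context: For integers $k\ge t$, a $(v,k,t)$ packing of size $b$ is a system of $b$ subsets (blocks) of a $v$-element underlying set such that each block has exactly $k$ elements and every $t$-element set is contained in at most one block. $P(v,k,t)$ denotes the maximum possible size $b$ of a $(v,k,t)$ packing. -}

module Defs where

open import Data.Fin.Base using (Fin; funToFin; finToFun)
import Data.Fin.Properties as Fin
open import Data.Fin.Subset using (Subset; _⊆_; ∣_∣)
open import Data.Fin.Subset.Properties using (_⊆?_; anySubset?)
open import Data.Nat.Base using (ℕ; zero; suc; _≤_; _^_)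
open import Data.Nat.Primality using (Prime)
open import Data.Nat.Properties using (_≟_; m≤n⇒m<n∨m≡n; m<1+n⇒m≤n)
open import Data.Product.Base using (Σ; ∃; _×_; _,_)
open import Data.Sum.Base using (inj₁; inj₂)
open import Data.Vec.Base using (Vec; []; _∷_; lookup)
open import Data.Vec.Properties using (≡-dec; tabulate∘lookup; tabulate-cong)
import Data.Bool.Properties as Bool
open import Function.Base using (_∘_)
open import Function.Bundles using (Inverse)
open import Function.Definitions using (Injective)
open import Relation.Binary.PropositionalEquality
  using (_≡_; refl; sym; trans; cong)
open import Relation.Nullary using (Dec; yes; no; contradiction)
open import Relation.Nullary.Decidable
  using (map′; ¬?; _×-dec_; _→-dec_; decidable-stable)
open import Relation.Unary using (Decidable)

IsPrimePower : ℕ → Set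
IsPrimePower q = ∃ λ p → ∃ λ n → Prime p × 1 ≤ n × q ≡ p ^ n

-- For t ≤ k the field `distinct` follows from the other two; it is required
-- so that the size of a packing stays bounded for all v, k, t.
record IsPacking (v k t : ℕ) {b : ℕ} (B : Vec (Subset v) b) : Set where
  field
    distinct  : Injective _≡_ _≡_ (lookup B)
    blockSize : ∀ i → ∣ lookup B i ∣ ≡ k
    atMostOne : ∀ (T : Subset v) → ∣ T ∣ ≡ t →
                ∀ i j → T ⊆ lookup B i → T ⊆ lookup B j → i ≡ j

HasPacking : (v k t b : ℕ) → Set
HasPacking v k t b = Σ (Vec (Subset v) b) (IsPacking v k t)

allSubset? : ∀ {v} {Q : Subset v → Set} → Decidable Q → Dec (∀ T → Q T)
allSubset? Q? = map′
  (λ ¬∃ T → decidable-stable (Q? T) (λ ¬q → ¬∃ (T , ¬q)))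
  (λ ∀q (T , ¬q) → ¬q (∀q T))
  (¬? (anySubset? (λ T → ¬? (Q? T))))

anySubsetVec? : ∀ {v} b {Q : Vec (Subset v) b → Set} → Decidable Q → Dec (∃ Q)
anySubsetVec? zero    Q? = map′ ([] ,_) (λ { ([] , q) → q }) (Q? [])
anySubsetVec? (suc b) Q? = map′
  (λ (S , B , q) → S ∷ B , q)
  (λ { (S ∷ B , q) → S , B , q })
  (anySubset? (λ S → anySubsetVec? b (λ B → Q? (S ∷ B))))

isPacking? : ∀ v k t {b} → Decidable (IsPacking v k t {b})
isPacking? v k t B = map′
  (λ (d , s , u) → record
    { distinct = λ {i} {j} → d i j ; blockSize = s ; atMostOne = u })
  (λ p → let open IsPacking p in (λ i j → distinct {i} {j}) , blockSize , atMostOne)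
  (Fin.all? (λ i → Fin.all? (λ j →
      ≡-dec Bool._≟_ (lookup B i) (lookup B j) →-dec (i Fin.≟ j)))
   ×-dec Fin.all? (λ i → ∣ lookup B i ∣ ≟ k)
   ×-dec allSubset? (λ T → (∣ T ∣ ≟ t) →-dec
      Fin.all? (λ i → Fin.all? (λ j →
        (T ⊆? lookup B i) →-dec ((T ⊆? lookup B j) →-dec (i Fin.≟ j))))))

hasPacking? : ∀ v k t → Decidable (HasPacking v k t)
hasPacking? v k t b = anySubsetVec? b (isPacking? v k t)

-- The largest m ≤ n satisfying Q, or 0 if there is none.
greatest : {Q : ℕ → Set} → Decidable Q → ℕ → ℕ
greatest Q? zero = zero
greatest Q? (suc n) with Q? (suc n)
... | yes _ = suc n
... | no  _ = greatest Q? n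

-- The cut-off 2 ^ v is harmless, as blocks are distinct subsets of Fin v;
-- P-attained and P-maximal show that this is the maximum over all packings.
P : (v k t : ℕ) → ℕ
P v k t = greatest (hasPacking? v k t) (2 ^ v)

greatest-attained : {Q : ℕ → Set} (Q? : Decidable Q) → Q 0 → ∀ n → Q (greatest Q? n)
greatest-attained Q? q₀ zero = q₀
greatest-attained Q? q₀ (suc n) with Q? (suc n)
... | yes q = q
... | no  _ = greatest-attained Q? q₀ n

greatest-maximal : {Q : ℕ → Set} (Q? : Decidable Q) →
                   ∀ n {m} → m ≤ n → Q m → m ≤ greatest Q? n
greatest-maximal Q? zero    m≤0 q = m≤0
greatest-maximal Q? (suc n) m≤1+n q with Q? (suc n)
... | yes _ = m≤1+n
... | no ¬q with m≤n⇒m<n∨m≡n m≤1+n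
...   | inj₁ m<1+n = greatest-maximal Q? n (m<1+n⇒m≤n m<1+n) q
...   | inj₂ refl  = contradiction q ¬q

packing-bound : ∀ {v k t b} → HasPacking v k t b → b ≤ 2 ^ v
packing-bound {v} (B , isP) =
  Fin.injective⇒≤ {f = code ∘ lookup B} (IsPacking.distinct isP ∘ code-injective)
  where
  open Inverse Fin.2↔Bool using (from; to; strictlyInverseˡ)

  code : Subset v → Fin (2 ^ v)
  code S = funToFin (from ∘ lookup S)

  decode : ∀ S i → to (finToFun (code S) i) ≡ lookup S i
  decode S i = trans (cong to (Fin.finToFun-funToFin (from ∘ lookup S) i))
                     (strictlyInverseˡ (lookup S i))

  code-injective : Injective _≡_ _≡_ code
  code-injective {S} {T} eq =
    trans (sym (tabulate∘lookup S))
      (trans (tabulate-cong (λ i → trans (sym (decode S i))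
                (trans (cong (λ c → to (finToFun c i)) eq) (decode T i))))
        (tabulate∘lookup T))

P-attained : ∀ v k t → HasPacking v k t (P v k t)
P-attained v k t = greatest-attained (hasPacking? v k t) empty (2 ^ v)
  where
  empty : HasPacking v k t 0
  empty = [] , record
    { distinct = λ { {()} } ; blockSize = λ () ; atMostOne = λ _ _ () }

P-maximal : ∀ {v k t b} → HasPacking v k t b → b ≤ P v k t
P-maximal {v} {k} {t} h =
  greatest-maximal (hasPacking? v k t) (2 ^ v) (packing-bound h) h

{-# OPTIONS --safe #-}
module Submission where

-- Let μ be the group of c-th roots of unity in F_q. The points are the origin of F_q² and the orbits
-- of μ on the other vectors. Each orbit of μ on the lines avoiding the origin gives a block: the q
-- points of a line lie in different orbits, and two such blocks share at most one point for every
-- element of μ. The union of c lines through the origin gives a further block of c (q − 1) / c + 1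
-- points; it meets a line avoiding the origin at most c times, and ⌊(q + 1) / c⌋ disjoint groups of
-- c such lines can be chosen.
--
-- The field F_q with q = pⁿ is a quotient of A = F_p[X]/(X^(q−1) − 1), in which a^q = a for all a.
-- The product u of X^(p^d) − X over 0 < d < n has degree < q − 1 and so is non-zero in A. For a
-- minimal idempotent e below u^(q−1), the ring eA is a field in which the n conjugates of y = eX are
-- distinct. Being roots of any relation over F_p between 1, y, …, y^(n−1), they force these to be
-- independent, so eA has at least q elements, and at most q because all are roots of Y^q − Y.

open import Defs
open import Algebra.Bundles using (CommutativeRing)
import Algebra.Properties.AbelianGroup as AbelianGroupProperties
import Algebra.Properties.CommutativeSemiring.Binomial as Binomial
import Algebra.Properties.CommutativeSemiring.Exp as Exp
import Algebra.Properties.Ring as RingProperties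
import Algebra.Properties.Semiring.Mult as Mult
import Algebra.Properties.Semiring.Sum as Sum
import Algebra.Solver.Ring.NaturalCoefficients.Default as SemiringSolver
open import Data.Bool.Base using (if_then_else_)
open import Data.Empty using (⊥)
open import Data.Fin.Base as Fin
  using (Fin; zero; suc; toℕ; fromℕ; inject₁; inject≤; finToFun; funToFin; punchIn; punchOut; combine;
         remQuot; splitAt; join)
import Data.Fin.Properties as Fin
open import Data.Fin.Subset using (Subset; inside; outside; _∈_; _⊆_; ∣_∣)
import Data.Integer.Base as ℤ
import Data.Integer.Divisibility.Signed as ℤ
import Data.Integer.DivMod as ℤ
import Data.Integer.Properties as ℤ
open import Data.List.Base as List using (List; []; _∷_; length)
open import Data.List.Membership.Propositional using (lose) renaming (_∈_ to _∈ₗ_)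
import Data.List.Membership.Propositional.Properties as ∈
import Data.List.Properties as List
open import Data.List.Relation.Unary.All as All using (All; []; _∷_)
import Data.List.Relation.Unary.All.Properties as All
open import Data.List.Relation.Unary.AllPairs as AllPairs using (AllPairs; []; _∷_)
import Data.List.Relation.Unary.AllPairs.Properties as AllPairs
open import Data.List.Relation.Unary.Any as Any using (Any; here; there)
import Data.List.Relation.Unary.Any.Properties as Any
open import Data.List.Relation.Unary.Unique.DecSetoid.Properties using (deduplicate-!)
open import Data.Nat.Base as ℕ using (ℕ; zero; suc; z≤n; s≤s; NonZero; _!)
open import Data.Nat.Combinatorics using (_C_; nCn≡1; nCk≡n!/k![n-k]!; k![n∸k]!∣n!)
open import Data.Nat.Coprimality using (prime⇒coprime; coprime-Bézout)
import Data.Nat.Divisibility as ℕ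
import Data.Nat.DivMod as ℕ
open import Data.Nat.GCD using (module Bézout)
open import Data.Nat.Primality using (Prime; euclidsLemma; prime⇒nonZero; prime⇒nonTrivial)
import Data.Nat.Properties as ℕ
open import Data.Nat.Solver using (module +-*-Solver)
open import Data.Product.Base using (Σ; ∃; _×_; _,_; proj₁; proj₂)
open import Data.Sum.Base using (_⊎_; inj₁; inj₂)
open import Data.Unit.Base using (⊤; tt)
open import Data.Vec.Base as Vec using ([]; _∷_; here; there)
import Data.Vec.Properties as Vec
open import Function.Base using (_∘_; _$_; id)
open import Function.Definitions using (Injective)
open import Level using (0ℓ; _⊔_)
open import Relation.Binary.Bundles using (DecSetoid)
open import Relation.Binary.Definitions using (tri<; tri≈; tri>)
open import Relation.Binary.PropositionalEquality as ≡ using (_≡_; _≢_)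
open import Relation.Nullary using (¬_; Dec; yes; no; contradiction)
open import Relation.Nullary.Decidable using (does; map′; dec-true)
open import Relation.Unary using (Pred; Decidable)
open import Relation.Unary.Properties using (∁?)

-- Ideals and polynomial roots

-- No irreducible polynomial is sought and no algebra is decomposed. In A the identity a^q = a needs
-- a check only for scalars and for X, because the q-th power map is additive and multiplicative. It
-- makes every a^(q - 1) idempotent, and non-zero whenever a is, which is all that the search for a
-- minimal idempotent needs. The factor X^(p^d) - X of u vanishes in a quotient field where the
-- image of X returns to itself after d Frobenius steps; a quotient in which u survives is therefore
-- large enough. The degrees of these factors add up to at most q - 2. In the plane, neither lines
-- nor orbits are formed as sets. A line avoiding the origin is f = 1 for a non-zero linear form f,
-- and its orbit is f^c = 1, a condition that is constant on classes of vectors. Vectors and forms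
-- are classified alike, by q + 1 directions and (q - 1)/c scales, whence (q^2 - 1)/c non-zero
-- points and as many line blocks. At a common point of the blocks of f and g, g = ρ f with ρ in μ,
-- and each ρ determines the direction of the point.

module _ {a ℓ} (R : CommutativeRing a ℓ) where

  open CommutativeRing R
  open Exp commutativeSemiring using (_^_)
  open Mult semiring using () renaming (_×_ to _·_)

  Nontrivial : Set ℓ
  Nontrivial = ¬ 1# ≈ 0#

  NoZeroDivisors : Set (a ⊔ ℓ)
  NoZeroDivisors = ∀ {x y} → x * y ≈ 0# → ¬ x ≈ 0# → y ≈ 0#

  DecidableZero : Set (a ⊔ ℓ)
  DecidableZero = ∀ x → Dec (x ≈ 0#)

  HasCharacteristic : ℕ → Set (a ⊔ ℓ)
  HasCharacteristic p = ∀ x → p · x ≈ 0#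

  FixedByPower : ℕ → Set (a ⊔ ℓ)
  FixedByPower k = ∀ x → x ^ k ≈ x

record IsIdeal {a ℓ ℓ′} (R : CommutativeRing a ℓ) (I : Pred (CommutativeRing.Carrier R) ℓ′) :
               Set (a ⊔ ℓ ⊔ ℓ′) where
  open CommutativeRing R
  field
    I-resp   : ∀ {x y} → x ≈ y → I x → I y
    0∈I      : I 0#
    +-closed : ∀ {x y} → I x → I y → I (x + y)
    *-closed : ∀ x {y} → I y → I (x * y)

module Quotient {a ℓ ℓ′} (R : CommutativeRing a ℓ) {I : Pred (CommutativeRing.Carrier R) ℓ′}
  (isIdeal : IsIdeal R I) where

  open CommutativeRing R hiding (zero)
  open IsIdeal isIdeal

  private
    open RingProperties ring using (-1*x≈-x)
    open AbelianGroupProperties +-abelianGroup using (⁻¹-∙-comm)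
    open import Relation.Binary.Reasoning.Setoid setoid

    neg-closed : ∀ {x} → I x → I (- x)
    neg-closed {x} Ix = I-resp (-1*x≈-x x) (*-closed (- 1#) Ix)

  infix 4 _∼_

  -- A record, so that the operands can be inferred from a proof.
  record _∼_ (x y : Carrier) : Set (a ⊔ ℓ ⊔ ℓ′) where
    constructor congruent
    field
      offset     : Carrier
      offset∈I   : I offset
      x≈y+offset : x ≈ y + offset

  ≈⇒∼ : ∀ {x y} → x ≈ y → x ∼ y
  ≈⇒∼ x≈y = congruent 0# 0∈I $ trans x≈y (sym (+-identityʳ _))

  ∈⇒∼0 : ∀ {x} → I x → x ∼ 0#
  ∈⇒∼0 Ix = congruent _ Ix $ sym (+-identityˡ _)

  ∼0⇒∈ : ∀ {x} → x ∼ 0# → I x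
  ∼0⇒∈ (congruent i Ii eq) = I-resp (sym (trans eq (+-identityˡ i))) Ii

  ∼-sym : ∀ {x y} → x ∼ y → y ∼ x
  ∼-sym {x} {y} (congruent i Ii x≈y+i) = congruent (- i) (neg-closed Ii) (begin
    y              ≈⟨ +-identityʳ y ⟨
    y + 0#         ≈⟨ +-congˡ (-‿inverseʳ i) ⟨
    y + (i + - i)  ≈⟨ +-assoc y i (- i) ⟨
    y + i + - i    ≈⟨ +-congʳ x≈y+i ⟨
    x + - i        ∎)

  ∼-trans : ∀ {x y z} → x ∼ y → y ∼ z → x ∼ z
  ∼-trans {x} {y} {z} (congruent i Ii x≈y+i) (congruent j Ij y≈z+j) = congruent (j + i) (+-closed Ij Ii) (begin
    x            ≈⟨ x≈y+i ⟩
    y + i        ≈⟨ +-congʳ y≈z+j ⟩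
    z + j + i    ≈⟨ +-assoc z j i ⟩
    z + (j + i)  ∎)

  +-∼-cong : ∀ {x x′ y y′} → x ∼ x′ → y ∼ y′ → x + y ∼ x′ + y′
  +-∼-cong {x} {x′} {y} {y′} (congruent i Ii x≈) (congruent j Ij y≈) = congruent (i + j) (+-closed Ii Ij) (begin
    x + y                 ≈⟨ +-cong x≈ y≈ ⟩
    (x′ + i) + (y′ + j)   ≈⟨ solve 4 (λ x i y j → (x :+ i) :+ (y :+ j) := (x :+ y) :+ (i :+ j))
                              refl x′ i y′ j ⟩
    (x′ + y′) + (i + j)   ∎)
    where open SemiringSolver commutativeSemiring

  *-∼-cong : ∀ {x x′ y y′} → x ∼ x′ → y ∼ y′ → x * y ∼ x′ * y′
  *-∼-cong {x} {x′} {y} {y′} (congruent i Ii x≈) (congruent j Ij y≈) =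
    congruent ((x′ + i) * j + y′ * i) (+-closed (*-closed _ Ij) (*-closed y′ Ii)) (begin
    x * y                                ≈⟨ *-cong x≈ y≈ ⟩
    (x′ + i) * (y′ + j)                  ≈⟨ solve 4 (λ x i y j →
                                              (x :+ i) :* (y :+ j) := x :* y :+ ((x :+ i) :* j :+ y :* i))
                                              refl x′ i y′ j ⟩
    x′ * y′ + ((x′ + i) * j + y′ * i)    ∎)
    where open SemiringSolver commutativeSemiring

  -‿∼-cong : ∀ {x y} → x ∼ y → - x ∼ - y
  -‿∼-cong {x} {y} (congruent i Ii x≈y+i) =
    congruent (- i) (neg-closed Ii) (trans (-‿cong x≈y+i) (sym (⁻¹-∙-comm y i)))

  quotient : CommutativeRing a (a ⊔ ℓ ⊔ ℓ′)
  quotient = record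
    { Carrier = Carrier ; _≈_ = _∼_ ; _+_ = _+_ ; _*_ = _*_ ; -_ = -_ ; 0# = 0# ; 1# = 1#
    ; isCommutativeRing = record
      { isRing = record
        { +-isAbelianGroup = record
          { isGroup = record
            { isMonoid = record
              { isSemigroup = record
                { isMagma = record
                  { isEquivalence = record { refl = ≈⇒∼ refl ; sym = ∼-sym ; trans = ∼-trans }
                  ; ∙-cong = +-∼-cong }
                ; assoc = λ x y z → ≈⇒∼ (+-assoc x y z) }
              ; identity = ≈⇒∼ ∘ +-identityˡ , ≈⇒∼ ∘ +-identityʳ }
            ; inverse = ≈⇒∼ ∘ -‿inverseˡ , ≈⇒∼ ∘ -‿inverseʳ
            ; ⁻¹-cong = -‿∼-cong }
          ; comm = λ x y → ≈⇒∼ (+-comm x y) }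
        ; *-cong = *-∼-cong
        ; *-assoc = λ x y z → ≈⇒∼ (*-assoc x y z)
        ; *-identity = ≈⇒∼ ∘ *-identityˡ , ≈⇒∼ ∘ *-identityʳ
        ; distrib = (λ x y z → ≈⇒∼ (distribˡ x y z)) , (λ x y z → ≈⇒∼ (distribʳ x y z)) }
      ; *-comm = λ x y → ≈⇒∼ (*-comm x y) } }

  open CommutativeRing quotient using () renaming (+-congʳ to +-∼-congʳ)

  ∼⇒-∈ : ∀ {x y} → x ∼ y → I (x - y)
  ∼⇒-∈ x∼y = ∼0⇒∈ (∼-trans (+-∼-congʳ x∼y) (≈⇒∼ (-‿inverseʳ _)))

  -∈⇒∼ : ∀ {x y} → I (x - y) → x ∼ y
  -∈⇒∼ {x} {y} I[x-y] = congruent (x - y) I[x-y] $ sym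
    (trans (+-comm y (x - y)) (trans (+-assoc x (- y) y) (trans (+-congˡ (-‿inverseˡ y)) (+-identityʳ x))))

  private
    module R = Exp commutativeSemiring
    module Q = Exp (CommutativeRing.commutativeSemiring quotient)
    module R+ = Mult semiring
    module Q+ = Mult (CommutativeRing.semiring quotient)

  ^-quotient : ∀ x n → x Q.^ n ≡ x R.^ n
  ^-quotient x zero    = ≡.refl
  ^-quotient x (suc n) = ≡.cong (x *_) (^-quotient x n)

  ×-quotient : ∀ n x → n Q+.× x ≡ n R+.× x
  ×-quotient zero    x = ≡.refl
  ×-quotient (suc n) x = ≡.cong (x +_) (×-quotient n x)

module PolynomialRoots {a ℓ} (R : CommutativeRing a ℓ) (noZeroDivisors : NoZeroDivisors R) where

  open CommutativeRing R hiding (zero)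
  open Exp commutativeSemiring using (_^_)
  open AbelianGroupProperties +-abelianGroup using (x∙y⁻¹≈ε⇒x≈y)
  open RingProperties ring using ([y-z]x≈yx-zx)
  open import Relation.Binary.Reasoning.Setoid setoid
  open SemiringSolver commutativeSemiring using (solve; _:=_; _:+_; _:*_)

  -- Polynomials are represented by their functions. A Horner scheme ending in a non-zero constant
  -- certifies the exact degree, which is what root counting needs.
  data HasDegree : ℕ → (Carrier → Carrier) → Set (a ⊔ ℓ) where
    constant : ∀ {f} c → ¬ c ≈ 0# → (∀ x → f x ≈ c) → HasDegree 0 f
    horner   : ∀ {f g d} c → HasDegree d g → (∀ x → f x ≈ c + x * g x) → HasDegree (suc d) f

  ^-hasDegree : Nontrivial R → ∀ d → HasDegree d (_^ d)
  ^-hasDegree 1≉0 zero    = constant 1# 1≉0 λ _ → refl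
  ^-hasDegree 1≉0 (suc d) = horner 0# (^-hasDegree 1≉0 d) λ x → sym (+-identityˡ _)

  +-const-hasDegree : ∀ {d f} c → HasDegree (suc d) f → HasDegree (suc d) (λ x → f x + c)
  +-const-hasDegree c (horner b h f≈) =
    horner (b + c) h λ x → trans (+-congʳ (f≈ x))
      (solve 3 (λ b c t → b :+ t :+ c := b :+ c :+ t) refl b c _)

  -- f x − f α = (x − α) h x, with both sides moved so that no subtraction occurs.
  factor : ∀ {d f} → HasDegree (suc d) f → ∀ α →
           ∃ λ h → HasDegree d h × ∀ x → f x + α * h x ≈ f α + x * h x
  factor {f = f} (horner {g = g} b (constant c c≉0 g≈c) f≈) α =
    g , constant c c≉0 g≈c , λ x → begin
      f x + α * g x              ≈⟨ +-cong (f≈ x) (*-congˡ (trans (g≈c x) (sym (g≈c α)))) ⟩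
      b + x * g x + α * g α      ≈⟨ solve 3 (λ b s t → b :+ s :+ t := b :+ t :+ s) refl b _ _ ⟩
      b + α * g α + x * g x      ≈⟨ +-congʳ (f≈ α) ⟨
      f α + x * g x              ∎
  factor {f = f} (horner {g = g} b deg-g@(horner _ _ _) f≈) α with factor deg-g α
  ... | h , deg-h , g≈ = (λ x → g α + x * h x) , horner (g α) deg-h (λ _ → refl) , λ x → begin
    f x + α * (g α + x * h x)               ≈⟨ +-congʳ (f≈ x) ⟩
    b + x * g x + α * (g α + x * h x)       ≈⟨ solve 6 (λ b x gx α gα hx →
         b :+ x :* gx :+ α :* (gα :+ x :* hx) := b :+ α :* gα :+ x :* (gx :+ α :* hx))
         refl b x _ α _ _ ⟩
    b + α * g α + x * (g x + α * h x)       ≈⟨ +-cong (sym (f≈ α)) (*-congˡ (g≈ x)) ⟩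
    f α + x * (g α + x * h x)               ∎

  -- Splitting off one root α leaves a cofactor h of lower degree, and any other root β satisfies (α
  -- - β) h β = 0.
  roots≤degree : ∀ {d f} → HasDegree d f → ∀ {αs} → AllPairs (λ x y → ¬ x ≈ y) αs →
                 All (λ α → f α ≈ 0#) αs → length αs ℕ.≤ d
  roots≤degree _ [] [] = z≤n
  roots≤degree (constant c c≉0 f≈) (_ ∷ _) (fα≈0 ∷ _) = contradiction (trans (sym (f≈ _)) fα≈0) c≉0
  roots≤degree {f = f} deg@(horner _ _ _) {α ∷ _} (α≉ ∷ unique) (fα≈0 ∷ roots) with factor deg α
  ... | h , deg-h , f≈ = s≤s (roots≤degree deg-h unique (All.map root (All.zip (α≉ , roots))))
    where
    root : ∀ {β} → (¬ α ≈ β) × f β ≈ 0# → h β ≈ 0#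
    root {β} (α≉β , fβ≈0) = noZeroDivisors
      (begin
        (α - β) * h β      ≈⟨ [y-z]x≈yx-zx (h β) α β ⟩
        α * h β - β * h β  ≈⟨ +-congʳ (begin
           α * h β            ≈⟨ +-identityˡ _ ⟨
           0# + α * h β       ≈⟨ +-congʳ fβ≈0 ⟨
           f β + α * h β      ≈⟨ f≈ β ⟩
           f α + β * h β      ≈⟨ +-congʳ fα≈0 ⟩
           0# + β * h β       ≈⟨ +-identityˡ _ ⟩
           β * h β            ∎) ⟩
        β * h β - β * h β  ≈⟨ -‿inverseʳ _ ⟩
        0#                 ∎)
      (α≉β ∘ x∙y⁻¹≈ε⇒x≈y α β)

-- Binomial coefficients modulo p and the Frobenius map

p∤k! : ∀ {p} → Prime p → ∀ k → k ℕ.< p → ¬ p ℕ.∣ k !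
p∤k! pp zero    k<p p∣1 = ℕ.>⇒∤ (ℕ.nonTrivial⇒n>1 _ {{prime⇒nonTrivial pp}}) p∣1
p∤k! pp (suc k) k<p p∣k! with euclidsLemma (suc k) (k !) pp p∣k!
... | inj₁ p∣k = ℕ.>⇒∤ k<p p∣k
... | inj₂ p∣k! = p∤k! pp k (ℕ.<-trans (ℕ.n<1+n k) k<p) p∣k!

n∣n! : ∀ n .{{_ : NonZero n}} → n ℕ.∣ n !
n∣n! (suc n) = ℕ.m∣m*n (n !)

-- p divides p! = C(p, k) k! (p - k)!, but neither factorial, since both are products of numbers
-- below p.
p∣pCk : ∀ {p} → Prime p → ∀ k → 0 ℕ.< k → k ℕ.< p → p ℕ.∣ p C k
p∣pCk {p} pp k 0<k k<p with euclidsLemma (p C k) (k ! ℕ.* (p ℕ.∸ k) !) pp p∣product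
  where
  instance
    _ = prime⇒nonZero pp
    _ = k ℕ.!* (p ℕ.∸ k) !≢0

  p∣product : p ℕ.∣ (p C k) ℕ.* (k ! ℕ.* (p ℕ.∸ k) !)
  p∣product = ≡.subst (p ℕ.∣_) (≡.sym (≡.trans
    (≡.cong (ℕ._* (k ! ℕ.* (p ℕ.∸ k) !)) (nCk≡n!/k![n-k]! (ℕ.<⇒≤ k<p)))
    (ℕ.m/n*n≡m (k![n∸k]!∣n! (ℕ.<⇒≤ k<p))))) (n∣n! p)
... | inj₁ p∣C = p∣C
... | inj₂ p∣k!j! with euclidsLemma (k !) ((p ℕ.∸ k) !) pp p∣k!j!
...   | inj₁ p∣k! = contradiction p∣k! (p∤k! pp k k<p)
...   | inj₂ p∣j! = contradiction p∣j! (p∤k! pp (p ℕ.∸ k) (ℕ.∸-monoʳ-< 0<k (ℕ.<⇒≤ k<p)))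

module Frobenius {a ℓ} (R : CommutativeRing a ℓ) {p} (prime : Prime p) (char : HasCharacteristic R p) where

  open CommutativeRing R hiding (zero)
  open Mult semiring using () renaming (_×_ to _·_)
  open Exp commutativeSemiring using (_^_; ^-congˡ; ^-assocʳ)
  open Mult semiring hiding (_×_)
  open Sum semiring using (sum; sum-init-last; sum-cong-≋; sum-replicate-zero)
  open import Relation.Binary.Reasoning.Setoid setoid

  p∣n⇒n·x≈0 : ∀ {n} → p ℕ.∣ n → ∀ x → n · x ≈ 0#
  p∣n⇒n·x≈0 (ℕ.divides-refl k) x = begin
    (k ℕ.* p) · x    ≈⟨ ×-congˡ (ℕ.*-comm k p) ⟩
    (p ℕ.* k) · x    ≈⟨ ×-assocˡ x p k ⟨
    p · (k · x)      ≈⟨ char _ ⟩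
    0#               ∎

  private
    -- Every binomial term except the outer two is a multiple of p. Writing the exponent as `suc n`
    -- lets the first and last terms split off the sum.
    ^1+n-distrib-+ : ∀ n → suc n ≡ p → ∀ x y → (x + y) ^ suc n ≈ x ^ suc n + y ^ suc n
    ^1+n-distrib-+ n ≡.refl x y = begin
      (x + y) ^ suc n                             ≈⟨ Binomial.theorem commutativeSemiring (suc n) x y ⟩
      t zero + sum (t ∘ suc)                      ≈⟨ +-congˡ (sum-init-last (t ∘ suc)) ⟩
      t zero + (sum (t ∘ suc ∘ inject₁) + t (suc (fromℕ n)))
        ≈⟨ +-cong (trans (+-identityʳ _) (*-identityˡ _)) (+-cong middle last) ⟩
      y ^ suc n + (0# + x ^ suc n)                ≈⟨ +-congˡ (+-identityˡ _) ⟩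
      y ^ suc n + x ^ suc n                       ≈⟨ +-comm _ _ ⟩
      x ^ suc n + y ^ suc n                       ∎
      where
      t = Binomial.binomialTerm commutativeSemiring x y (suc n)

      middle : sum (t ∘ suc ∘ inject₁) ≈ 0#
      middle = trans
        (sum-cong-≋ {n} λ i → p∣n⇒n·x≈0 (p∣pCk prime (suc (toℕ (inject₁ i))) (s≤s z≤n)
          (s≤s (≡.subst (ℕ._< n) (≡.sym (Fin.toℕ-inject₁ i)) (Fin.toℕ<n i)))) _)
        (sum-replicate-zero n)

      last : t (suc (fromℕ n)) ≈ x ^ suc n
      last rewrite Fin.toℕ-fromℕ n | nCn≡1 (suc n) | ℕ.n∸n≡0 n =
        trans (+-identityʳ _) (*-identityʳ _)

  ^p-distrib-+ : ∀ x y → (x + y) ^ p ≈ x ^ p + y ^ p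
  ^p-distrib-+ = ≡.subst (λ k → ∀ x y → (x + y) ^ k ≈ x ^ k + y ^ k)
    (ℕ.suc-pred p) (^1+n-distrib-+ (ℕ.pred p) (ℕ.suc-pred p))
    where instance _ = prime⇒nonZero prime

  ^p^k-distrib-+ : ∀ k x y → (x + y) ^ (p ℕ.^ k) ≈ x ^ (p ℕ.^ k) + y ^ (p ℕ.^ k)
  ^p^k-distrib-+ zero x y = trans (*-identityʳ _) (sym (+-cong (*-identityʳ x) (*-identityʳ y)))
  ^p^k-distrib-+ (suc k) x y = begin
    (x + y) ^ (p ℕ.* p ℕ.^ k)                             ≈⟨ ^-assocʳ (x + y) p _ ⟨
    ((x + y) ^ p) ^ (p ℕ.^ k)                             ≈⟨ ^-congˡ (p ℕ.^ k) (^p-distrib-+ x y) ⟩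
    (x ^ p + y ^ p) ^ (p ℕ.^ k)                           ≈⟨ ^p^k-distrib-+ k (x ^ p) (y ^ p) ⟩
    (x ^ p) ^ (p ℕ.^ k) + (y ^ p) ^ (p ℕ.^ k)             ≈⟨ +-cong (^-assocʳ x p _) (^-assocʳ y p _) ⟩
    x ^ (p ℕ.* p ℕ.^ k) + y ^ (p ℕ.* p ℕ.^ k)             ∎

  0^p≈0 : 0# ^ p ≈ 0#
  0^p≈0 = ≡.subst (λ k → 0# ^ k ≈ 0#) (ℕ.suc-pred p) (zeroˡ _)
    where instance _ = prime⇒nonZero prime

  1^k≈1 : ∀ k → 1# ^ k ≈ 1#
  1^k≈1 zero    = refl
  1^k≈1 (suc k) = trans (*-identityˡ _) (1^k≈1 k)

  -- Fermat's little theorem, by induction from additivity of the p-th power.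
  [n·1]^p≈n·1 : ∀ n → (n · 1#) ^ p ≈ n · 1#
  [n·1]^p≈n·1 zero    = 0^p≈0
  [n·1]^p≈n·1 (suc n) = trans (^p-distrib-+ 1# (n · 1#)) (+-cong (1^k≈1 p) ([n·1]^p≈n·1 n))

  ^p-fixed⇒^p^k-fixed : ∀ {x} → x ^ p ≈ x → ∀ k → x ^ (p ℕ.^ k) ≈ x
  ^p-fixed⇒^p^k-fixed         x^p≈x zero    = *-identityʳ _
  ^p-fixed⇒^p^k-fixed {x = x} x^p≈x (suc k) =
    trans (sym (^-assocʳ x p _)) (trans (^-congˡ (p ℕ.^ k) x^p≈x) (^p-fixed⇒^p^k-fixed x^p≈x k))

-- Minimal idempotents

module MinimalIdempotent {a ℓ} (R : CommutativeRing a ℓ) (0? : DecidableZero R)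
  (m : ℕ) (x^[1+m]≈x : FixedByPower R (suc m)) where

  open CommutativeRing R hiding (zero)
  open import Relation.Binary.Reasoning.Setoid setoid
  open Exp commutativeSemiring using (_^_)
  open SemiringSolver commutativeSemiring using (solve; _:=_; _:+_; _:*_)

  xᵐ*x≈x : ∀ x → x ^ m * x ≈ x
  xᵐ*x≈x x = trans (*-comm _ _) (x^[1+m]≈x x)

  ^m-idempotent : .{{NonZero m}} → ∀ x → x ^ m * x ^ m ≈ x ^ m
  ^m-idempotent x = idem m (xᵐ*x≈x x)
    where
    idem : ∀ k .{{_ : NonZero k}} → x ^ k * x ≈ x → x ^ k * x ^ k ≈ x ^ k
    idem (suc k) eq = trans (sym (*-assoc _ x _)) (*-congʳ eq)

  -- Each a is treated in turn. If e a^m = 0, then e is kept, and a = a^m a gives f a = 0 for all f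
  -- below e. Otherwise e shrinks to e a^m, on which a^m acts as the identity. Both outcomes survive
  -- further shrinking.
  minimalBelow : .{{NonZero m}} → ∀ as {e} → e * e ≈ e → ¬ e ≈ 0# →
           ∃ λ f → f * f ≈ f × ¬ f ≈ 0# × f * e ≈ f ×
                   All (λ a → f * a ≈ 0# ⊎ f * a ^ m ≈ f) as
  minimalBelow [] {e} ee≈e e≉0 = e , ee≈e , e≉0 , ee≈e , []
  minimalBelow (a ∷ as) {e} ee≈e e≉0 with 0? (e * a ^ m)
  ... | yes eaᵐ≈0 with f , ff≈f , f≉0 , fe≈f , min ← minimalBelow as ee≈e e≉0 =
        f , ff≈f , f≉0 , fe≈f , inj₁ fa≈0 ∷ min
    where
    fa≈0 : f * a ≈ 0#
    fa≈0 = begin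
      f * a                  ≈⟨ *-cong (sym fe≈f) (sym (xᵐ*x≈x a)) ⟩
      f * e * (a ^ m * a)    ≈⟨ solve 4 (λ f e b a → f :* e :* (b :* a) := f :* a :* (e :* b))
                                 refl f e _ a ⟩
      f * a * (e * a ^ m)    ≈⟨ *-congˡ eaᵐ≈0 ⟩
      f * a * 0#             ≈⟨ zeroʳ _ ⟩
      0#                     ∎
  ... | no eaᵐ≉0 =
        let f , ff≈f , f≉0 , fe′≈f , min = minimalBelow as e′e′≈e′ eaᵐ≉0
            absorb : ∀ {z} → (e * a ^ m) * z ≈ e * a ^ m → f * z ≈ f
            absorb e′z≈e′ = trans (*-congʳ (sym fe′≈f)) (trans (*-assoc f _ _) (trans (*-congˡ e′z≈e′) fe′≈f))
        in f , ff≈f , f≉0 , absorb e′e≈e′ , inj₂ (absorb e′aᵐ≈e′) ∷ min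
    where
    e′e′≈e′ : (e * a ^ m) * (e * a ^ m) ≈ e * a ^ m
    e′e′≈e′ = begin
      (e * a ^ m) * (e * a ^ m)  ≈⟨ solve 2 (λ e b → (e :* b) :* (e :* b) := (e :* e) :* (b :* b)) refl e _ ⟩
      (e * e) * (a ^ m * a ^ m)  ≈⟨ *-cong ee≈e (^m-idempotent a) ⟩
      e * a ^ m                  ∎

    e′e≈e′ : (e * a ^ m) * e ≈ e * a ^ m
    e′e≈e′ = trans (solve 2 (λ e b → (e :* b) :* e := (e :* e) :* b) refl e _) (*-congʳ ee≈e)

    e′aᵐ≈e′ : (e * a ^ m) * a ^ m ≈ e * a ^ m
    e′aᵐ≈e′ = trans (*-assoc e _ _) (*-congˡ (^m-idempotent a))

-- Conjugates as roots, and the p^n elements they provide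

module _ {a ℓ} (R : CommutativeRing a ℓ) where

  open CommutativeRing R
  open Exp commutativeSemiring using (_^_)

  -- Comparison with y alone suffices in a domain of characteristic p: injectivity of Frobenius
  -- reduces any two conjugates to this case.
  DistinctConjugates : (p n : ℕ) → Carrier → Set ℓ
  DistinctConjugates p n y = ∀ d → 0 ℕ.< d → d ℕ.< n → ¬ y ^ (p ℕ.^ d) ≈ y

module ConjugateBasis {a ℓ} (R : CommutativeRing a ℓ)
  (noZeroDivisors : NoZeroDivisors R) (1≉0 : Nontrivial R) (0? : DecidableZero R)
  {p n} (prime : Prime p) (char : HasCharacteristic R p)
  (y : CommutativeRing.Carrier R) (y-conjugates : DistinctConjugates R p n y) where

  open CommutativeRing R hiding (zero)
  open Mult semiring using () renaming (_×_ to _·_)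
  open AbelianGroupProperties +-abelianGroup using (x∙y⁻¹≈ε⇒x≈y; x≈y⇒x∙y⁻¹≈ε)
  open RingProperties ring using (+-cancelʳ)
  open Mult semiring hiding (_×_)
  open Exp commutativeSemiring using (_^_; ^-congˡ; ^-assocʳ; ^-distrib-*)
  open Frobenius R prime char
  open PolynomialRoots R noZeroDivisors
  open import Relation.Binary.Reasoning.Setoid setoid
  open SemiringSolver commutativeSemiring using (solve; _:=_; _:+_; _:*_)

  -- k is coprime to p, so a Bézout identity would turn k · 1 = 0 into 1 = 0.
  k·1≉0 : ∀ k → 0 ℕ.< k → k ℕ.< p → ¬ k · 1# ≈ 0#
  k·1≉0 k@(suc _) _ k<p k·1≈0 with coprime-Bézout (prime⇒coprime prime k<p)
  ... | Bézout.+- u v eq = 1≉0 (begin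
    1#                          ≈⟨ +-identityʳ 1# ⟨
    1# + 0#                     ≈⟨ +-congˡ (k-multiple v) ⟨
    (1 ℕ.+ v ℕ.* k) · 1#        ≈⟨ ×-congˡ eq ⟩
    (u ℕ.* p) · 1#              ≈⟨ p∣n⇒n·x≈0 (ℕ.divides-refl u) 1# ⟩
    0#                          ∎)
    where
    k-multiple : ∀ v → (v ℕ.* k) · 1# ≈ 0#
    k-multiple v = trans (×1-homo-* v k) (trans (*-congˡ k·1≈0) (zeroʳ _))
  ... | Bézout.-+ u v eq = 1≉0 (begin
    1#                          ≈⟨ +-identityʳ 1# ⟨
    1# + 0#                     ≈⟨ +-congˡ (p∣n⇒n·x≈0 (ℕ.divides-refl u) 1#) ⟨
    (1 ℕ.+ u ℕ.* p) · 1#        ≈⟨ ×-congˡ eq ⟩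
    (v ℕ.* k) · 1#              ≈⟨ ×1-homo-* v k ⟩
    (v · 1#) * (k · 1#)         ≈⟨ *-congˡ k·1≈0 ⟩
    (v · 1#) * 0#               ≈⟨ zeroʳ _ ⟩
    0#                          ∎)

  ·1-injective-< : ∀ {i j} → i ℕ.< j → j ℕ.< p → ¬ i · 1# ≈ j · 1#
  ·1-injective-< {i} {j} i<j j<p i≈j = k·1≉0 (j ℕ.∸ i) (ℕ.m<n⇒0<n∸m i<j)
    (ℕ.≤-<-trans (ℕ.m∸n≤m j i) j<p)
    (+-cancelʳ (i · 1#) _ _ (begin
      (j ℕ.∸ i) · 1# + i · 1#     ≈⟨ ×-homo-+ 1# (j ℕ.∸ i) i ⟨
      (j ℕ.∸ i ℕ.+ i) · 1#        ≈⟨ ×-congˡ (ℕ.m∸n+n≡m (ℕ.<⇒≤ i<j)) ⟩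
      j · 1#                      ≈⟨ i≈j ⟨
      i · 1#                      ≈⟨ +-identityˡ _ ⟨
      0# + i · 1#                 ∎))

  ·1-injective : ∀ {i j : Fin p} → toℕ i · 1# ≈ toℕ j · 1# → i ≡ j
  ·1-injective {i} {j} eq with ℕ.<-cmp (toℕ i) (toℕ j)
  ... | tri< i<j _ _ = contradiction eq (·1-injective-< i<j (Fin.toℕ<n j))
  ... | tri≈ _ i≡j _ = Fin.toℕ-injective i≡j
  ... | tri> _ _ j<i = contradiction (sym eq) (·1-injective-< j<i (Fin.toℕ<n i))

  -- Additivity turns equal powers into (x - z)^(p^k) = 0, and a domain has no nilpotents other than
  -- 0. Adding z^(p^k) back avoids powers of a negative.
  ^p^k-injective : ∀ k {x z} → x ^ (p ℕ.^ k) ≈ z ^ (p ℕ.^ k) → x ≈ z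
  ^p^k-injective k {x} {z} eq = x∙y⁻¹≈ε⇒x≈y x z (x^k≈0⇒x≈0 (p ℕ.^ k)
    (+-cancelʳ (z ^ (p ℕ.^ k)) _ _ (begin
      (x - z) ^ (p ℕ.^ k) + z ^ (p ℕ.^ k)   ≈⟨ ^p^k-distrib-+ k (x - z) z ⟨
      (x - z + z) ^ (p ℕ.^ k)               ≈⟨ ^-congˡ (p ℕ.^ k) x-z+z≈x ⟩
      x ^ (p ℕ.^ k)                         ≈⟨ eq ⟩
      z ^ (p ℕ.^ k)                         ≈⟨ +-identityˡ _ ⟨
      0# + z ^ (p ℕ.^ k)                    ∎)))
    where
    x-z+z≈x : x - z + z ≈ x
    x-z+z≈x = trans (+-assoc x (- z) z) (trans (+-congˡ (-‿inverseˡ z)) (+-identityʳ x))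

    x^k≈0⇒x≈0 : ∀ k {x} → x ^ k ≈ 0# → x ≈ 0#
    x^k≈0⇒x≈0 zero         1≈0 = contradiction 1≈0 1≉0
    x^k≈0⇒x≈0 (suc k) {x} x*xᵏ≈0 with 0? x
    ... | yes x≈0 = x≈0
    ... | no  x≉0 = x^k≈0⇒x≈0 k (noZeroDivisors x*xᵏ≈0 x≉0)

  ev : ∀ k → (Fin k → Carrier) → Carrier → Carrier
  ev zero    c x = 0#
  ev (suc k) c x = c zero + x * ev k (c ∘ suc) x

  ev-cong : ∀ k c {x z} → x ≈ z → ev k c x ≈ ev k c z
  ev-cong zero    c x≈z = refl
  ev-cong (suc k) c x≈z = +-congˡ (*-cong x≈z (ev-cong k (c ∘ suc) x≈z))

  ev-+ : ∀ k c c′ x → ev k (λ i → c i + c′ i) x ≈ ev k c x + ev k c′ x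
  ev-+ zero    c c′ x = sym (+-identityʳ 0#)
  ev-+ (suc k) c c′ x = trans (+-congˡ (*-congˡ (ev-+ k (c ∘ suc) (c′ ∘ suc) x)))
    (solve 5 (λ a b x s t → a :+ b :+ x :* (s :+ t) := a :+ x :* s :+ (b :+ x :* t))
      refl (c zero) (c′ zero) x _ _)

  ev-0 : ∀ k c x → (∀ i → c i ≈ 0#) → ev k c x ≈ 0#
  ev-0 zero    c x c≈0 = refl
  ev-0 (suc k) c x c≈0 = trans (+-cong (c≈0 zero) (trans (*-congˡ (ev-0 k _ x (c≈0 ∘ suc))) (zeroʳ x)))
    (+-identityʳ 0#)

  -- Deciding which coefficients vanish finds the true leading one, as root counting requires an
  -- exact degree.
  ev-degree : ∀ k c → (∀ i → c i ≈ 0#) ⊎ (∃ λ d → d ℕ.< k × HasDegree d (ev k c))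
  ev-degree zero    c = inj₁ λ ()
  ev-degree (suc k) c with ev-degree k (c ∘ suc)
  ... | inj₂ (d , d<k , deg) = inj₂ (suc d , s≤s d<k , horner (c zero) deg λ _ → refl)
  ... | inj₁ tail≈0 with 0? (c zero)
  ...   | yes c₀≈0 = inj₁ λ { zero → c₀≈0 ; (suc i) → tail≈0 i }
  ...   | no  c₀≉0 = inj₂ (0 , s≤s z≤n , constant (c zero) c₀≉0 λ x →
            trans (+-congˡ (trans (*-congˡ (ev-0 k _ x tail≈0)) (zeroʳ x))) (+-identityʳ _))

  ev-^p : ∀ k c → (∀ i → c i ^ p ≈ c i) → ∀ x → ev k c (x ^ p) ≈ ev k c x ^ p
  ev-^p zero    c fixed x = sym 0^p≈0
  ev-^p (suc k) c fixed x = begin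
    c zero + x ^ p * ev k (c ∘ suc) (x ^ p)         ≈⟨ +-cong (sym (fixed zero)) (*-congˡ (ev-^p k _ (fixed ∘ suc) x)) ⟩
    c zero ^ p + x ^ p * ev k (c ∘ suc) x ^ p       ≈⟨ +-congˡ (^-distrib-* x _ p) ⟨
    c zero ^ p + (x * ev k (c ∘ suc) x) ^ p         ≈⟨ ^p-distrib-+ _ _ ⟨
    (c zero + x * ev k (c ∘ suc) x) ^ p             ∎

  conjugates-distinct : ∀ {i j} → i ℕ.< j → j ℕ.< n → ¬ y ^ (p ℕ.^ i) ≈ y ^ (p ℕ.^ j)
  conjugates-distinct {i} {j} i<j j<n eq =
    y-conjugates (j ℕ.∸ i) (ℕ.m<n⇒0<n∸m i<j) (ℕ.≤-<-trans (ℕ.m∸n≤m j i) j<n)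
      (sym (^p^k-injective i (trans eq (trans (reflexive (≡.cong (y ^_) p^j≡)) (sym (^-assocʳ y (p ℕ.^ (j ℕ.∸ i)) (p ℕ.^ i)))))))
    where
    p^j≡ : p ℕ.^ j ≡ p ℕ.^ (j ℕ.∸ i) ℕ.* p ℕ.^ i
    p^j≡ = ≡.trans (≡.cong (p ℕ.^_) (≡.sym (ℕ.m∸n+n≡m (ℕ.<⇒≤ i<j)))) (ℕ.^-distribˡ-+-* p (j ℕ.∸ i) i)

  -- Frobenius fixes the coefficients and therefore maps roots to roots.
  conjugate-root : ∀ k c → (∀ i → c i ^ p ≈ c i) → ev k c y ≈ 0# → ∀ i → ev k c (y ^ (p ℕ.^ i)) ≈ 0#
  conjugate-root k c fixed root zero = trans (ev-cong k c (*-identityʳ y)) root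
  conjugate-root k c fixed root (suc i) = begin
    ev k c (y ^ (p ℕ.* p ℕ.^ i))     ≈⟨ ev-cong k c (trans (reflexive (≡.cong (y ^_) (ℕ.*-comm p _))) (sym (^-assocʳ y (p ℕ.^ i) p))) ⟩
    ev k c ((y ^ (p ℕ.^ i)) ^ p)     ≈⟨ ev-^p k c fixed _ ⟩
    ev k c (y ^ (p ℕ.^ i)) ^ p       ≈⟨ ^-congˡ p (conjugate-root k c fixed root i) ⟩
    0# ^ p                           ≈⟨ 0^p≈0 ⟩
    0#                               ∎

  -- A non-trivial relation would be a polynomial of degree below n with the n distinct conjugates
  -- of y as roots.
  independent : ∀ c → (∀ i → c i ^ p ≈ c i) → ev n c y ≈ 0# → ∀ i → c i ≈ 0#
  independent c fixed root with ev-degree n c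
  ... | inj₁ c≈0 = c≈0
  ... | inj₂ (d , d<n , deg) = contradiction n≤d (ℕ.<⇒≱ d<n)
    where
    n≤d : n ℕ.≤ d
    n≤d = ≡.subst (ℕ._≤ d) (List.length-tabulate {n = n} _) (roots≤degree deg
      (AllPairs.tabulate⁺-< {n = n} {f = λ i → y ^ (p ℕ.^ toℕ i)}
        λ {_} {j} i<j → conjugates-distinct i<j (Fin.toℕ<n j))
      (All.tabulate⁺ λ i → conjugate-root n c fixed root (toℕ i)))

  -- The base-p digits of the index serve as coefficients of 1, y, ..., y^(n-1).
  element : Fin (p ℕ.^ n) → Carrier
  element i = ev n (λ j → toℕ (finToFun {n = n} i j) · 1#) y

  negated-fixed : ∀ {x} → x ^ p ≈ x → (- x) ^ p ≈ - x
  negated-fixed {x} x^p≈x = +-cancelʳ x _ _ (begin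
    (- x) ^ p + x       ≈⟨ +-congˡ x^p≈x ⟨
    (- x) ^ p + x ^ p   ≈⟨ ^p-distrib-+ (- x) x ⟨
    (- x + x) ^ p       ≈⟨ ^-congˡ p (-‿inverseˡ x) ⟩
    0# ^ p              ≈⟨ 0^p≈0 ⟩
    0#                  ≈⟨ -‿inverseˡ x ⟨
    - x + x             ∎)

  element-injective : ∀ {i j} → element i ≈ element j → i ≡ j
  element-injective {i} {j} eq = ≡.trans (≡.sym (Fin.funToFin-finToFin {n} i))
    (≡.trans (funToFin-cong n λ k → ·1-injective (x∙y⁻¹≈ε⇒x≈y _ _
      (independent (λ k → digit i k - digit j k) difference-fixed difference-root k)))
    (Fin.funToFin-finToFin {n} j))
    where
    digit : Fin (p ℕ.^ n) → Fin n → Carrier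
    digit i k = toℕ (finToFun {n = n} i k) · 1#

    funToFin-cong : ∀ m {f g : Fin m → Fin p} → (∀ k → f k ≡ g k) → funToFin f ≡ funToFin g
    funToFin-cong zero    f≡g = ≡.refl
    funToFin-cong (suc m) f≡g = ≡.cong₂ Fin.combine (f≡g zero) (funToFin-cong m (f≡g ∘ suc))

    difference-fixed : ∀ k → (digit i k - digit j k) ^ p ≈ digit i k - digit j k
    difference-fixed k = trans (^p-distrib-+ _ _) (+-cong ([n·1]^p≈n·1 (toℕ (finToFun {n = n} i k)))
      (negated-fixed ([n·1]^p≈n·1 (toℕ (finToFun {n = n} j k)))))

    difference-root : ev n (λ k → digit i k - digit j k) y ≈ 0#
    difference-root = +-cancelʳ (element j) _ _ (begin
      ev n (λ k → digit i k - digit j k) y + element j   ≈⟨ ev-+ n _ _ y ⟨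
      ev n (λ k → digit i k - digit j k + digit j k) y   ≈⟨ ev-coeff-cong n (λ k →
                                                             trans (+-assoc _ _ _) (trans (+-congˡ (-‿inverseˡ _)) (+-identityʳ _))) ⟩
      element i                                          ≈⟨ eq ⟩
      element j                                          ≈⟨ +-identityˡ _ ⟨
      0# + element j                                     ∎)
      where
      ev-coeff-cong : ∀ m {c c′ : Fin m → Carrier} → (∀ k → c k ≈ c′ k) → ev m c y ≈ ev m c′ y
      ev-coeff-cong zero    c≈ = refl
      ev-coeff-cong (suc m) c≈ = +-cong (c≈ zero) (*-congˡ (ev-coeff-cong m (c≈ ∘ suc)))

  -- An x missed by `element` would be, beside the p^n listed elements, one root too many of Y^q -
  -- Y, q = p^n.
  element-surjective : 2 ℕ.≤ p ℕ.^ n → FixedByPower R (p ℕ.^ n) → ∀ x → ∃ λ i → element i ≈ x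
  element-surjective 2≤q x^q≈x x with Fin.any? (λ i → map′ (x∙y⁻¹≈ε⇒x≈y _ _) x≈y⇒x∙y⁻¹≈ε (0? (element i - x)))
  ... | yes found = found
  ... | no ¬found = contradiction
      (≡.subst (λ l → suc l ℕ.≤ p ℕ.^ n) (List.length-tabulate element)
        (roots≤degree (degree (p ℕ.^ n) 2≤q) {x ∷ List.tabulate element}
          (All.tabulate⁺ (λ i x≈ → ¬found (i , sym x≈)) ∷ AllPairs.tabulate⁺ (λ i≢j → i≢j ∘ element-injective))
          (root x ∷ All.tabulate⁺ (root ∘ element))))
      ℕ.1+n≰n
    where
    degree : ∀ k → 2 ℕ.≤ k → HasDegree k (λ z → z ^ k - z)
    -- From k ≥ 2 on, the term -z stays below the leading one: z^k - z = z (z^(k-1) - 1).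
    degree (suc (suc k)) _ = horner 0# (+-const-hasDegree (- 1#) (^-hasDegree 1≉0 (suc k)))
      λ z → begin
        z * z ^ suc k - z                  ≈⟨ +-congˡ (trans (-‿cong (sym (*-identityʳ z))) (-‿distribʳ-* z 1#)) ⟩
        z * z ^ suc k + z * - 1#           ≈⟨ distribˡ z _ _ ⟨
        z * (z ^ suc k + - 1#)             ≈⟨ +-identityˡ _ ⟨
        0# + z * (z ^ suc k + - 1#)        ∎
      where open RingProperties ring using (-‿distribʳ-*)
    degree (suc zero) (s≤s ())

    root : ∀ z → z ^ (p ℕ.^ n) - z ≈ 0#
    root z = trans (+-congʳ (x^q≈x z)) (-‿inverseʳ z)

-- Finite fields

module IntegersModulo (p : ℕ) (prime : Prime p) where

  open import Data.Integer.Base using (+_)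

  private
    instance _ = prime⇒nonZero prime

  multiples : IsIdeal ℤ.+-*-commutativeRing (+ p ℤ.∣_)
  multiples = record
    { I-resp   = λ { ≡.refl → id }
    ; 0∈I      = ℤ.divides (+ 0) ≡.refl
    ; +-closed = ℤ.∣m∣n⇒∣m+n
    ; *-closed = λ x → ℤ.∣n⇒∣m*n x }

  module Mod = Quotient ℤ.+-*-commutativeRing multiples

  ℤ/p : CommutativeRing 0ℓ 0ℓ
  ℤ/p = Mod.quotient

  open CommutativeRing ℤ/p hiding (zero)
  open Mult semiring using (×-assoc-*; ×-congʳ) renaming (_×_ to _·_)

  n·1≡+n : ∀ n → n · 1# ≡ + n
  n·1≡+n zero    = ≡.refl
  n·1≡+n (suc n) = ≡.cong ℤ.suc (n·1≡+n n)

  char : HasCharacteristic ℤ/p p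
  char x = trans (×-congʳ p (sym (*-identityˡ x))) (trans (sym (×-assoc-* p 1# x))
    (trans (*-congʳ (trans (reflexive (n·1≡+n p)) (Mod.∈⇒∼0 ℤ.∣-refl))) (zeroˡ x)))

  0? : DecidableZero ℤ/p
  0? x = map′ Mod.∈⇒∼0 Mod.∼0⇒∈ (+ p ℤ.∣? x)

  1≉0 : Nontrivial ℤ/p
  1≉0 1≈0 = ℕ.>⇒∤ (ℕ.nonTrivial⇒n>1 p {{prime⇒nonTrivial prime}}) (ℤ.∣⇒∣ᵤ (Mod.∼0⇒∈ 1≈0))

  residue : ∀ x → ∃ λ n → n ℕ.< p × x ≈ n · 1#
  residue x = x ℤ.%ℕ p , ℤ.n%ℕd<d x p ,
    Mod.congruent (x ℤ./ℕ p ℤ.* + p) (ℤ.∣n⇒∣m*n (x ℤ./ℕ p) ℤ.∣-refl)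
      (≡.trans (ℤ.a≡a%ℕn+[a/ℕn]*n x p) (≡.cong (λ r → r ℤ.+ x ℤ./ℕ p ℤ.* + p) (≡.sym (n·1≡+n _))))

-- The algebra K[X]/(Xᵐ − 1): an expression denotes an operator on sequences, X being the shift,
-- and two expressions are identified when they agree on the m-periodic sequence δ.
module ShiftAlgebra (K : CommutativeRing 0ℓ 0ℓ) (m : ℕ) .{{m≢0 : NonZero m}} where

  open CommutativeRing K hiding (zero)
  open import Relation.Binary.Reasoning.Setoid setoid
  open SemiringSolver commutativeSemiring using (solve; _:=_; _:+_; _:*_)

  infixl 6 _⊕_
  infixl 7 _⊗_

  data Expr : Set where
    const   : Carrier → Expr
    𝕏       : Expr
    _⊕_ _⊗_ : Expr → Expr → Expr

  act : Expr → (ℕ → Carrier) → ℕ → Carrier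
  act (const k) s i = k * s i
  act 𝕏         s i = s (suc i)
  act (a ⊕ b)   s i = act a s i + act b s i
  act (a ⊗ b)   s   = act a (act b s)

  act-cong : ∀ a {s t} → (∀ i → s i ≈ t i) → ∀ i → act a s i ≈ act a t i
  act-cong (const k) s≈t i = *-congˡ (s≈t i)
  act-cong 𝕏         s≈t i = s≈t (suc i)
  act-cong (a ⊕ b)   s≈t i = +-cong (act-cong a s≈t i) (act-cong b s≈t i)
  act-cong (a ⊗ b)   s≈t   = act-cong a (act-cong b s≈t)

  act-+ : ∀ a s t i → act a (λ i → s i + t i) i ≈ act a s i + act a t i
  act-+ (const k) s t i = distribˡ k (s i) (t i)
  act-+ 𝕏         s t i = refl
  act-+ (a ⊕ b)   s t i = trans (+-cong (act-+ a s t i) (act-+ b s t i))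
    (solve 4 (λ u v w z → (u :+ v) :+ (w :+ z) := (u :+ w) :+ (v :+ z)) refl _ _ _ _)
  act-+ (a ⊗ b)   s t i = trans (act-cong a (act-+ b s t) i) (act-+ a _ _ i)

  act-* : ∀ a k s i → act a (λ i → k * s i) i ≈ k * act a s i
  act-* (const l) k s i = solve 3 (λ l k x → l :* (k :* x) := k :* (l :* x)) refl l k (s i)
  act-* 𝕏         k s i = refl
  act-* (a ⊕ b)   k s i = trans (+-cong (act-* a k s i) (act-* b k s i)) (sym (distribˡ k _ _))
  act-* (a ⊗ b)   k s i = trans (act-cong a (act-* b k s) i) (act-* a k _ i)

  act-shift : ∀ a s i → act a (s ∘ suc) i ≈ act a s (suc i)
  act-shift (const k) s i = refl
  act-shift 𝕏         s i = refl
  act-shift (a ⊕ b)   s i = +-cong (act-shift a s i) (act-shift b s i)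
  act-shift (a ⊗ b)   s i = trans (act-cong a (act-shift b s) i) (act-shift a _ i)

  -- All operators are built from scalars and the shift, and linearity and shift invariance say that
  -- every operator commutes with these.
  act-comm : ∀ a b s i → act a (act b s) i ≈ act b (act a s) i
  act-comm (const k) b s i = sym (act-* b k s i)
  act-comm 𝕏         b s i = sym (act-shift b s i)
  act-comm (a ⊕ a′)  b s i = trans (+-cong (act-comm a b s i) (act-comm a′ b s i)) (sym (act-+ b _ _ i))
  act-comm (a ⊗ a′)  b s i = trans (act-cong a (act-comm a′ b s) i) (act-comm a b _ i)

  -- The 1 sits at the end of each period, at index m - 1 in the first, so that X^k with k < m
  -- brings it down to m - 1 - k and zeros precede it.
  δ : ℕ → Carrier
  δ i = if does (m ℕ.∣? suc i) then 1# else 0#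

  δ-∣ : ∀ {i} → m ℕ.∣ suc i → δ i ≈ 1#
  δ-∣ {i} m∣ with m ℕ.∣? suc i
  ... | yes _ = refl
  ... | no m∤ = contradiction m∣ m∤

  δ-∤ : ∀ {i} → ¬ m ℕ.∣ suc i → δ i ≈ 0#
  δ-∤ {i} m∤ with m ℕ.∣? suc i
  ... | yes m∣ = contradiction m∣ m∤
  ... | no _ = refl

  δ-periodic : ∀ i → δ (m ℕ.+ i) ≈ δ i
  δ-periodic i with m ℕ.∣? suc i
  ... | yes m∣ = δ-∣ (≡.subst (m ℕ.∣_) (ℕ.+-suc m i) (ℕ.∣m∣n⇒∣m+n ℕ.∣-refl m∣))
  ... | no m∤  = δ-∤ (λ m∣ → m∤ (ℕ.∣m+n∣m⇒∣n (≡.subst (m ℕ.∣_) (≡.sym (ℕ.+-suc m i)) m∣) ℕ.∣-refl))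

  infix 4 _≃_

  -- A record, so that the operands can be inferred from a proof.
  record _≃_ (a b : Expr) : Set where
    constructor agree
    field at : ∀ i → act a δ i ≈ act b δ i
  open _≃_ public

  -- Equality is tested on δ alone, so it is only usable on the factor next to δ; commutativity
  -- brings each factor there.
  ⊗-cong : ∀ {a a′ b b′} → a ≃ a′ → b ≃ b′ → a ⊗ b ≃ a′ ⊗ b′
  ⊗-cong {a} {a′} {b} {b′} a≃a′ b≃b′ = agree λ i → begin
    act a (act b δ) i     ≈⟨ act-cong a (at b≃b′) i ⟩
    act a (act b′ δ) i    ≈⟨ act-comm a b′ δ i ⟩
    act b′ (act a δ) i    ≈⟨ act-cong b′ (at a≃a′) i ⟩
    act b′ (act a′ δ) i   ≈⟨ act-comm b′ a′ δ i ⟩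
    act a′ (act b′ δ) i   ∎

  algebra : CommutativeRing 0ℓ 0ℓ
  algebra = record
    { Carrier = Expr ; _≈_ = _≃_ ; _+_ = _⊕_ ; _*_ = _⊗_ ; -_ = const (- 1#) ⊗_
    ; 0# = const 0# ; 1# = const 1#
    ; isCommutativeRing = record
      { isRing = record
        { +-isAbelianGroup = record
          { isGroup = record
            { isMonoid = record
              { isSemigroup = record
                { isMagma = record
                  { isEquivalence = record
                    { refl = agree λ _ → refl
                    ; sym = λ a≃b → agree λ i → sym (at a≃b i)
                    ; trans = λ a≃b b≃c → agree λ i → trans (at a≃b i) (at b≃c i) }
                  ; ∙-cong = λ a≃a′ b≃b′ → agree λ i → +-cong (at a≃a′ i) (at b≃b′ i) }
                ; assoc = λ a b c → agree λ i → +-assoc _ _ _ }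
              ; identity = (λ a → agree λ i → trans (+-congʳ (zeroˡ _)) (+-identityˡ _))
                         , (λ a → agree λ i → trans (+-congˡ (zeroˡ _)) (+-identityʳ _)) }
            ; inverse = (λ a → agree λ i → trans (+-comm _ _) (negate _)) , (λ a → agree λ i → negate _)
            ; ⁻¹-cong = λ a≃b → agree λ i → *-congˡ (at a≃b i) }
          ; comm = λ a b → agree λ i → +-comm _ _ }
        ; *-cong = ⊗-cong
        ; *-assoc = λ a b c → agree λ i → refl
        ; *-identity = (λ a → agree λ i → *-identityˡ _)
                     , (λ a → agree λ i → trans (act-* a 1# δ i) (*-identityˡ _))
        ; distrib = (λ a b c → agree λ i → act-+ a _ _ i) , (λ a b c → agree λ i → refl) }
      ; *-comm = λ a b → agree λ i → act-comm a b δ i } }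
    where
    open RingProperties ring using (-1*x≈-x)
    negate : ∀ x {y} → x + - 1# * x ≈ 0# * y
    negate x = trans (+-congˡ (-1*x≈-x x)) (trans (-‿inverseʳ x) (sym (zeroˡ _)))

  private
    module A = CommutativeRing algebra
    open Exp A.commutativeSemiring using (_^_)

  act-𝕏^ : ∀ k s i → act (𝕏 ^ k) s i ≈ s (k ℕ.+ i)
  act-𝕏^ zero    s i = *-identityˡ _
  act-𝕏^ (suc k) s i = trans (act-𝕏^ k s (suc i)) (reflexive (≡.cong s (ℕ.+-suc k i)))

  𝕏^m≃1 : 𝕏 ^ m ≃ const 1#
  𝕏^m≃1 = agree λ i → trans (act-𝕏^ m δ i) (trans (δ-periodic i) (sym (*-identityˡ _)))

  act-shifts : ∀ k a s i → act a (λ i → s (k ℕ.+ i)) i ≈ act a s (k ℕ.+ i)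
  act-shifts zero    a s i = refl
  act-shifts (suc k) a s i = trans (act-shifts k a (s ∘ suc) i) (act-shift a s (k ℕ.+ i))

  act-periodic : ∀ a k i → act a δ (i ℕ.+ k ℕ.* m) ≈ act a δ i
  act-periodic a zero    i = reflexive (≡.cong (act a δ) (ℕ.+-identityʳ i))
  act-periodic a (suc k) i = begin
    act a δ (i ℕ.+ (m ℕ.+ k ℕ.* m))            ≡⟨ ≡.cong (act a δ) (≡.trans (≡.sym (ℕ.+-assoc i m _))
                                                   (≡.trans (≡.cong (ℕ._+ k ℕ.* m) (ℕ.+-comm i m)) (ℕ.+-assoc m i _))) ⟩
    act a δ (m ℕ.+ (i ℕ.+ k ℕ.* m))            ≈⟨ act-shifts m a δ _ ⟨
    act a (λ i → δ (m ℕ.+ i)) (i ℕ.+ k ℕ.* m)  ≈⟨ act-cong a δ-periodic _ ⟩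
    act a δ (i ℕ.+ k ℕ.* m)                    ≈⟨ act-periodic a k i ⟩
    act a δ i                                  ∎

  agree-below-m : ∀ {a b} → (∀ {i} → i ℕ.< m → act a δ i ≈ act b δ i) → a ≃ b
  agree-below-m {a} {b} eq = agree λ i → begin
    act a δ i                                 ≡⟨ ≡.cong (act a δ) (ℕ.m≡m%n+[m/n]*n i m) ⟩
    act a δ (i ℕ.% m ℕ.+ (i ℕ./ m) ℕ.* m)     ≈⟨ act-periodic a (i ℕ./ m) (i ℕ.% m) ⟩
    act a δ (i ℕ.% m)                         ≈⟨ eq (ℕ.m%n<n i m) ⟩
    act b δ (i ℕ.% m)                         ≈⟨ act-periodic b (i ℕ./ m) (i ℕ.% m) ⟨
    act b δ (i ℕ.% m ℕ.+ (i ℕ./ m) ℕ.* m)     ≡⟨ ≡.cong (act b δ) (ℕ.m≡m%n+[m/n]*n i m) ⟨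
    act b δ i                                 ∎

  ≃0? : DecidableZero K → DecidableZero algebra
  ≃0? 0? a = map′
    (λ a≈0 → agree-below-m {b = const 0#} λ i<m → trans (a≈0 i<m) (sym (zeroˡ _)))
    (λ a≃0 {i} _ → trans (at a≃0 i) (zeroˡ _))
    (ℕ.allUpTo? (λ i → 0? (act a δ i)) m)

  -- X^(m-1-j) moves the 1 of δ to index j. Below m, these shifts are thus the unit vectors, and the
  -- powers of X form a basis.
  δ-shifted : ∀ {i j} → i ℕ.< m → j ℕ.< m → i ≢ j → act (𝕏 ^ (m ℕ.∸ suc j)) δ i ≈ 0#
  δ-shifted {i} {j} i<m j<m i≢j = trans (act-𝕏^ (m ℕ.∸ suc j) δ i) (δ-∤ not-multiple)
    where
    t = m ℕ.∸ suc j

    m≡ : m ≡ suc (t ℕ.+ j)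
    m≡ = ≡.trans (≡.sym (ℕ.m∸n+n≡m j<m)) (ℕ.+-suc t j)

    not-multiple : ¬ m ℕ.∣ suc (t ℕ.+ i)
    not-multiple m∣ with ℕ.<-cmp i j
    ... | tri< i<j _ _ = ℕ.>⇒∤ (≡.subst (suc (t ℕ.+ i) ℕ.<_) (≡.sym m≡) (s≤s (ℕ.+-monoʳ-< t i<j))) m∣
    ... | tri≈ _ i≡j _ = i≢j i≡j
    ... | tri> _ _ j<i = ℕ.>⇒∤ {{ℕ.>-nonZero (ℕ.m<n⇒0<n∸m j<i)}} (ℕ.≤-<-trans (ℕ.m∸n≤m i j) i<m)
          (ℕ.∣m+n∣m⇒∣n (≡.subst (m ℕ.∣_) (≡.sym sum≡) m∣) ℕ.∣-refl)
      where
      sum≡ : m ℕ.+ (i ℕ.∸ j) ≡ suc (t ℕ.+ i)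
      sum≡ = ≡.trans (≡.cong (ℕ._+ (i ℕ.∸ j)) m≡) (≡.cong suc
        (≡.trans (ℕ.+-assoc t j _) (≡.cong (t ℕ.+_) (ℕ.m+[n∸m]≡n (ℕ.<⇒≤ j<i)))))

  δ-shifted-diagonal : ∀ {i} → i ℕ.< m → act (𝕏 ^ (m ℕ.∸ suc i)) δ i ≈ 1#
  δ-shifted-diagonal {i} i<m = trans (act-𝕏^ (m ℕ.∸ suc i) δ i)
    (δ-∣ (ℕ.∣-reflexive (≡.trans (≡.sym (ℕ.m∸n+n≡m i<m)) (ℕ.+-suc (m ℕ.∸ suc i) i))))

  -- The element whose sequence has the values w i at indices i < j and 0 at the other indices below
  -- m. With j = m and w = `act a δ` it recovers a.
  combination : (ℕ → Carrier) → ℕ → Expr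
  combination w zero    = const 0#
  combination w (suc j) = combination w j ⊕ const (w j) ⊗ 𝕏 ^ (m ℕ.∸ suc j)

  combination-≥ : ∀ w j {i} → i ℕ.< m → j ℕ.≤ i → act (combination w j) δ i ≈ 0#
  combination-≥ w zero    i<m j≤i = zeroˡ _
  combination-≥ w (suc j) i<m j<i = trans
    (+-cong (combination-≥ w j i<m (ℕ.<⇒≤ j<i))
            (trans (*-congˡ (δ-shifted i<m (ℕ.<-trans j<i i<m) (ℕ.>⇒≢ j<i))) (zeroʳ _)))
    (+-identityʳ _)

  combination-< : ∀ w j {i} → j ℕ.≤ m → i ℕ.< j → act (combination w j) δ i ≈ w i
  combination-< w (suc j) {i} j<m i<1+j with ℕ.m≤n⇒m<n∨m≡n (ℕ.m<1+n⇒m≤n i<1+j)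
  ... | inj₁ i<j    = trans
    (+-cong (combination-< w j (ℕ.<⇒≤ j<m) i<j)
            (trans (*-congˡ (δ-shifted (ℕ.<-trans i<j j<m) j<m (ℕ.<⇒≢ i<j))) (zeroʳ _)))
    (+-identityʳ _)
  ... | inj₂ ≡.refl = trans
    (+-cong (combination-≥ w j j<m ℕ.≤-refl)
            (trans (*-congˡ (δ-shifted-diagonal j<m)) (*-identityʳ _)))
    (+-identityˡ _)

  expansion : ∀ a → a ≃ combination (act a δ) m
  expansion a = agree-below-m {b = combination (act a δ) m} λ i<m → sym (combination-< (act a δ) m ℕ.≤-refl i<m)

  -- If ks represents all scalars, this represents all of the algebra at j = m, which makes the
  -- search for a minimal idempotent finite.
  combinations : List Carrier → ℕ → List Expr
  combinations ks zero    = const 0# ∷ []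
  combinations ks (suc j) =
    List.cartesianProductWith (λ t k → t ⊕ const k ⊗ 𝕏 ^ (m ℕ.∸ suc j)) (combinations ks j) ks

  combination∈ : ∀ {ks} → (∀ k → Any (k ≈_) ks) → ∀ w j → Any (combination w j ≃_) (combinations ks j)
  combination∈ k∈ w zero    = here A.refl
  combination∈ k∈ w (suc j) = Any.cartesianProductWith⁺ (λ t k → t ⊕ const k ⊗ 𝕏 ^ (m ℕ.∸ suc j))
    (λ t≃ k≈ → A.+-cong t≃ (A.*-congʳ (agree λ i → *-congʳ k≈)))
    (combination∈ k∈ w j) (k∈ (w j))

  -- A monic polynomial of degree k moves the leading 1 down by k places, so one of degree < m does
  -- not annihilate δ.
  Leads : (ℕ → Carrier) → ℕ → Set
  Leads s b = s b ≈ 1# × (∀ {i} → i ℕ.< b → s i ≈ 0#)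

  δ-leads : Leads δ (ℕ.pred m)
  δ-leads = δ-∣ (ℕ.∣-reflexive (≡.sym (ℕ.suc-pred m))) ,
    λ {i} i<m-1 → δ-∤ (ℕ.>⇒∤ (≡.subst (suc i ℕ.<_) (ℕ.suc-pred m) (s≤s i<m-1)))

  -- X^k moves the leading 1 from b to b - k. At indices up to b - k the term -X reads s at an index
  -- still below b, because k ≥ 2, and contributes 0.
  𝕏^k-𝕏-leads : ∀ {s b k} → 2 ℕ.≤ k → k ℕ.≤ b → Leads s b → Leads (act (𝕏 ^ k A.- 𝕏) s) (b ℕ.∸ k)
  𝕏^k-𝕏-leads {s} {b} {k} 2≤k k≤b (s[b]≈1 , s≈0) =
      trans (value (b ℕ.∸ k) (ℕ.≤-trans (ℕ.+-monoˡ-≤ (b ℕ.∸ k) 2≤k) (ℕ.≤-reflexive (ℕ.m+[n∸m]≡n k≤b))))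
        (trans (reflexive (≡.cong s (ℕ.m+[n∸m]≡n k≤b))) s[b]≈1)
    , λ {i} i<b-k → trans (value i (ℕ.≤-<-trans i<b-k (ℕ.∸-monoʳ-< {b} {k} {0} (ℕ.<⇒≤ 2≤k) k≤b)))
        (s≈0 (≡.subst (k ℕ.+ i ℕ.<_) (ℕ.m+[n∸m]≡n k≤b) (ℕ.+-monoʳ-< k i<b-k)))
    where
    value : ∀ i → suc i ℕ.< b → act (𝕏 ^ k A.- 𝕏) s i ≈ s (k ℕ.+ i)
    value i 1+i<b = trans (+-cong (act-𝕏^ k s i) (trans (*-congˡ (s≈0 1+i<b)) (zeroʳ _))) (+-identityʳ _)

record FiniteField (q : ℕ) : Set₁ where
  field
    commutativeRing : CommutativeRing 0ℓ 0ℓ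
  open CommutativeRing commutativeRing public hiding (zero)
  open Exp commutativeSemiring public using (_^_)
  field
    _≟_                : ∀ x y → Dec (x ≈ y)
    1≉0                : ¬ 1# ≈ 0#
    x^[q-1]≈1          : ∀ {x} → ¬ x ≈ 0# → x ^ (q ℕ.∸ 1) ≈ 1#
    element            : Fin q → Carrier
    element-injective  : ∀ {i j} → element i ≈ element j → i ≡ j
    element-surjective : ∀ x → ∃ λ i → element i ≈ x

-- The quotient of R by the annihilator of e is a field when e is a minimal idempotent.
module ResidueField (R : CommutativeRing 0ℓ 0ℓ) (0? : DecidableZero R) where

  open CommutativeRing R hiding (zero)
  open Exp commutativeSemiring using (_^_)

  module _ {p n : ℕ} (prime : Prime p) (char : HasCharacteristic R p) (a^q≈a : FixedByPower R (p ℕ.^ suc n))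
    (m : ℕ) .{{_ : NonZero m}} (1+m≡q : suc m ≡ p ℕ.^ suc n)
    (e : Carrier) (e≉0 : ¬ e ≈ 0#) (e-minimal : ∀ a → e * a ≈ 0# ⊎ e * a ^ m ≈ e)
    (y : Carrier) (y-conjugates : ∀ d → 0 ℕ.< d → d ℕ.≤ n → ¬ e * (y ^ (p ℕ.^ d) - y) ≈ 0#)
    where

    private
      q = p ℕ.^ suc n

    annihilator : IsIdeal R (λ a → e * a ≈ 0#)
    annihilator = record
      { I-resp   = λ a≈b ea≈0 → trans (*-congˡ (sym a≈b)) ea≈0
      ; 0∈I      = zeroʳ e
      ; +-closed = λ ea≈0 eb≈0 → trans (distribˡ e _ _) (trans (+-cong ea≈0 eb≈0) (+-identityʳ 0#))
      ; *-closed = λ a {b} eb≈0 →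
          trans (*-congˡ (*-comm a b)) (trans (sym (*-assoc e b a)) (trans (*-congʳ eb≈0) (zeroˡ a))) }

    module F = Quotient R annihilator

    private
      module F-ring = CommutativeRing F.quotient

    -- Minimality leaves e a^m = e, so e annihilates a^m - 1.
    a^m∼1 : ∀ {a} → ¬ a F.∼ 0# → a ^ m F.∼ 1#
    a^m∼1 {a} a≁0 with e-minimal a
    ... | inj₁ ea≈0  = contradiction (F.∈⇒∼0 ea≈0) a≁0
    ... | inj₂ eaᵐ≈e = F.-∈⇒∼ (begin
      e * (a ^ m - 1#)       ≈⟨ x[y-z]≈xy-xz e _ _ ⟩
      e * a ^ m - e * 1#     ≈⟨ +-cong eaᵐ≈e (-‿cong (*-identityʳ e)) ⟩
      e - e                  ≈⟨ -‿inverseʳ e ⟩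
      0#                     ∎)
      where
      open RingProperties ring using (x[y-z]≈xy-xz)
      open import Relation.Binary.Reasoning.Setoid setoid

    F-1≁0 : Nontrivial F.quotient
    F-1≁0 1∼0 = e≉0 (trans (sym (*-identityʳ e)) (F.∼0⇒∈ 1∼0))

    F-0? : DecidableZero F.quotient
    F-0? a = map′ (F.∈⇒∼0 {a}) (F.∼0⇒∈ {a}) (0? (e * a))

    F-noZeroDivisors : NoZeroDivisors F.quotient
    F-noZeroDivisors {a} {b} ab∼0 a≁0 = begin
      b                          ≈⟨ F-ring.*-identityˡ b ⟨
      1# * b                     ≈⟨ F-ring.*-congʳ (a^m∼1 a≁0) ⟨
      a ^ m * b                  ≡⟨ ≡.cong (λ k → a ^ k * b) (ℕ.suc-pred m) ⟨
      (a * a ^ ℕ.pred m) * b     ≈⟨ F-ring.*-congʳ (F-ring.*-comm a (a ^ ℕ.pred m)) ⟩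
      (a ^ ℕ.pred m * a) * b     ≈⟨ F-ring.*-assoc (a ^ ℕ.pred m) a b ⟩
      a ^ ℕ.pred m * (a * b)     ≈⟨ F-ring.*-congˡ ab∼0 ⟩
      a ^ ℕ.pred m * 0#          ≈⟨ F-ring.zeroʳ (a ^ ℕ.pred m) ⟩
      0#                         ∎
      where open import Relation.Binary.Reasoning.Setoid F-ring.setoid

    F-char : HasCharacteristic F.quotient p
    F-char a = F-ring.trans (F-ring.reflexive (F.×-quotient p a)) (F.≈⇒∼ (char a))

    F-y-conjugates : DistinctConjugates F.quotient p (suc n) y
    F-y-conjugates d 0<d d<1+n eq = y-conjugates d 0<d (ℕ.m<1+n⇒m≤n d<1+n)
      (F.∼⇒-∈ (≡.subst (F._∼ y) (F.^-quotient y (p ℕ.^ d)) eq))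

    private
      module Basis = ConjugateBasis F.quotient F-noZeroDivisors F-1≁0 F-0? {n = suc n} prime F-char y F-y-conjugates

    finiteField : FiniteField q
    finiteField = record
      { commutativeRing = F.quotient
      ; _≟_ = λ a b → map′ (F.-∈⇒∼ {a} {b}) (F.∼⇒-∈ {a} {b}) (0? (e * (a - b)))
      ; 1≉0 = F-1≁0
      ; x^[q-1]≈1 = λ {a} a≁0 → F-ring.trans
          (F-ring.reflexive (≡.trans (F.^-quotient a (q ℕ.∸ 1)) (≡.cong (λ k → a ^ (k ℕ.∸ 1)) (≡.sym 1+m≡q))))
          (a^m∼1 a≁0)
      ; element = Basis.element
      ; element-injective = Basis.element-injective
      ; element-surjective = Basis.element-surjective
          (≡.subst (2 ℕ.≤_) 1+m≡q (s≤s (ℕ.>-nonZero⁻¹ m)))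
          (λ a → F-ring.trans (F-ring.reflexive (F.^-quotient a q)) (F.≈⇒∼ (a^q≈a a)))
      }

-- The field of order q, with q = p^(n+1) and m = q - 1

module SplittingField (K : CommutativeRing 0ℓ 0ℓ) where

  private
    module K = CommutativeRing K
    module K× = Mult K.semiring
    module K^ = Exp K.commutativeSemiring

  module _ {p} (prime : Prime p) (K-char : HasCharacteristic K p) (K-1≉0 : Nontrivial K) (K-0? : DecidableZero K)
    (K-residue : ∀ x → ∃ λ n → n ℕ.< p × x K.≈ n K×.× K.1#)
    (m : ℕ) .{{_ : NonZero m}} (n : ℕ) (1+m≡q : suc m ≡ p ℕ.^ suc n)
    where

    private
      q = p ℕ.^ suc n
      module K-Frobenius = Frobenius K prime K-char
      instance _ = prime⇒nonZero prime

      2≤p : 2 ℕ.≤ p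
      2≤p = ℕ.nonTrivial⇒n>1 p {{prime⇒nonTrivial prime}}

    open ShiftAlgebra K m
    open CommutativeRing algebra hiding (zero)
    open Mult semiring using () renaming (_×_ to _·_)
    open Exp commutativeSemiring using (_^_; ^-congˡ; ^-distrib-*)

    private
      act-· : ∀ k a i → act (k · a) δ i K.≈ k K×.× act a δ i
      act-· zero    a i = K.zeroˡ _
      act-· (suc k) a i = K.+-congˡ (act-· k a i)

    algebra-char : HasCharacteristic algebra p
    algebra-char a = agree λ i → K.trans (act-· p a i) (K.trans (K-char _) (K.sym (K.zeroˡ _)))

    open Frobenius algebra prime algebra-char

    const-^ : ∀ k j → const k ^ j ≈ const (k K^.^ j)
    const-^ k zero    = refl
    const-^ k (suc j) = trans (*-congˡ (const-^ k j)) (agree λ i → K.sym (K.*-assoc _ _ _))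

    -- X^q = X comes from X^m = 1, scalars are fixed by Fermat, and the q-th power respects sums and
    -- products.
    a^q≈a : FixedByPower algebra q
    a^q≈a (const k) = trans (const-^ k q)
      (agree λ i → K.*-congʳ (K-Frobenius.^p-fixed⇒^p^k-fixed k^p≈k (suc n)))
      where
      k^p≈k : k K^.^ p K.≈ k
      k^p≈k = let r , _ , k≈r = K-residue k in
        K.trans (K^.^-congˡ p k≈r) (K.trans (K-Frobenius.[n·1]^p≈n·1 r) (K.sym k≈r))
    a^q≈a 𝕏 = trans (reflexive (≡.cong (𝕏 ^_) (≡.sym 1+m≡q))) (trans (*-congˡ 𝕏^m≃1) (*-identityʳ 𝕏))
    a^q≈a (a ⊕ b) = trans (^p^k-distrib-+ (suc n) a b) (+-cong (a^q≈a a) (a^q≈a b))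
    a^q≈a (a ⊗ b) = trans (^-distrib-* a b q) (*-cong (a^q≈a a) (a^q≈a b))

    -- The product of X^(p^i) - X over 0 < i ≤ d. As q = p^(n+1) here, `obstruction n` is the full
    -- product u.
    obstruction : ℕ → Expr
    obstruction zero    = 1#
    obstruction (suc d) = (𝕏 ^ (p ℕ.^ suc d) - 𝕏) * obstruction d

    -- The leading 1 starts at index q - 2. The invariant q ≤ b + p^(d+1) leaves room for the next
    -- factor: lowering b by k = p^(d+1) is paid for by p k ≥ 2 k.
    obstruction-leads : ∀ d → d ℕ.≤ n → ∃ λ b → Leads (act (obstruction d) δ) b × q ℕ.≤ b ℕ.+ p ℕ.^ suc d
    obstruction-leads zero _ = ℕ.pred m ,
      (K.trans (K.*-identityˡ _) (proj₁ δ-leads) , λ i< → K.trans (K.*-identityˡ _) (proj₂ δ-leads i<)) ,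
      (begin
        q                       ≡⟨ 1+m≡q ⟨
        suc m                   ≡⟨ ≡.cong suc (ℕ.suc-pred m) ⟨
        2 ℕ.+ ℕ.pred m          ≡⟨ ℕ.+-comm 2 (ℕ.pred m) ⟩
        ℕ.pred m ℕ.+ 2          ≤⟨ ℕ.+-monoʳ-≤ (ℕ.pred m) 2≤p ⟩
        ℕ.pred m ℕ.+ p          ≡⟨ ≡.cong (ℕ.pred m ℕ.+_) (ℕ.*-identityʳ p) ⟨
        ℕ.pred m ℕ.+ p ℕ.* 1    ∎)
      where open ℕ.≤-Reasoning
    obstruction-leads (suc d) d<n with obstruction-leads d (ℕ.<⇒≤ d<n)
    ... | b , leads , q≤b+k = b ℕ.∸ k , 𝕏^k-𝕏-leads 2≤k k≤b leads , (begin
        q                           ≤⟨ q≤b+k ⟩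
        b ℕ.+ k                     ≡⟨ ≡.cong (ℕ._+ k) (ℕ.m∸n+n≡m k≤b) ⟨
        b ℕ.∸ k ℕ.+ k ℕ.+ k         ≡⟨ ℕ.+-assoc (b ℕ.∸ k) k k ⟩
        b ℕ.∸ k ℕ.+ (k ℕ.+ k)       ≤⟨ ℕ.+-monoʳ-≤ (b ℕ.∸ k) k+k≤p*k ⟩
        b ℕ.∸ k ℕ.+ p ℕ.* k         ∎)
      where
      open ℕ.≤-Reasoning
      k = p ℕ.^ suc d

      2≤k : 2 ℕ.≤ k
      2≤k = ℕ.≤-trans 2≤p (ℕ.m≤m*n p (p ℕ.^ d) {{ℕ.m^n≢0 p d}})

      k+k≤p*k : k ℕ.+ k ℕ.≤ p ℕ.* k
      k+k≤p*k = ℕ.≤-trans (ℕ.≤-reflexive (≡.cong (k ℕ.+_) (≡.sym (ℕ.+-identityʳ k)))) (ℕ.*-monoˡ-≤ k 2≤p)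

      -- k + k ≤ p k = p^(d+2) ≤ q ≤ b + k, where d < n gives the middle inequality.
      k≤b : k ℕ.≤ b
      k≤b = ℕ.+-cancelʳ-≤ k k b (ℕ.≤-trans k+k≤p*k (ℕ.≤-trans (ℕ.^-monoʳ-≤ p (s≤s d<n)) q≤b+k))

    obstruction≉0 : ¬ obstruction n ≈ 0#
    obstruction≉0 eq with obstruction-leads n ℕ.≤-refl
    ... | b , (lead , _) , _ = K-1≉0 (K.trans (K.sym lead) (K.trans (at eq b) (K.zeroˡ _)))

    open MinimalIdempotent algebra (≃0? K-0?) m
      (λ a → trans (reflexive (≡.cong (a ^_) 1+m≡q)) (a^q≈a a))

    -- The search starts from u^m, which is non-zero since u^m u = u, and tests a complete list of
    -- representatives; minimality then passes to every a along its expansion.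
    minimalIdempotent : ∃ λ e → ¬ e ≈ 0# × e * obstruction n ^ m ≈ e ×
                               (∀ a → e * a ≈ 0# ⊎ e * a ^ m ≈ e)
    minimalIdempotent with minimalBelow (combinations scalars m) (^m-idempotent (obstruction n)) e₀≉0
      where
      scalars : List K.Carrier
      scalars = List.map (K×._× K.1#) (List.upTo p)

      e₀≉0 : ¬ obstruction n ^ m ≈ 0#
      e₀≉0 e₀≈0 = obstruction≉0 (trans (sym (xᵐ*x≈x _)) (trans (*-congʳ e₀≈0) (zeroˡ _)))
    ... | e , _ , e≉0 , e*e₀≈e , minimal = e , e≉0 , e*e₀≈e , e-minimal
      where
      scalar∈ : ∀ k → Any (k K.≈_) (List.map (K×._× K.1#) (List.upTo p))
      scalar∈ k = let r , r<p , k≈r = K-residue k in Any.map⁺ (lose (∈.∈-upTo⁺ r<p) k≈r)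

      e-minimal : ∀ a → e * a ≈ 0# ⊎ e * a ^ m ≈ e
      e-minimal a with All.lookupAny minimal
        (Any.map (trans (expansion a)) (combination∈ scalar∈ (act a δ) m))
      ... | inj₁ eb≈0 , a≈b = inj₁ (trans (*-congˡ a≈b) eb≈0)
      ... | inj₂ ebᵐ≈e , a≈b = inj₂ (trans (*-congˡ (^-congˡ m a≈b)) ebᵐ≈e)

    e*obstruction≉0 : ∀ {e} → ¬ e ≈ 0# → e * obstruction n ^ m ≈ e → ¬ e * obstruction n ≈ 0#
    e*obstruction≉0 {e} e≉0 e*uᵐ≈e e*u≈0 = e≉0 (trans (sym e*uᵐ≈e) (e*u^k≈0 m))
      where
      e*u^k≈0 : ∀ k .{{_ : NonZero k}} → e * obstruction n ^ k ≈ 0#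
      e*u^k≈0 (suc k) = trans (sym (*-assoc e _ _)) (trans (*-congʳ e*u≈0) (zeroˡ _))

    factor≉0 : ∀ {e} → ¬ e * obstruction n ≈ 0# → ∀ d → 0 ℕ.< d → d ℕ.≤ n → ¬ e * (𝕏 ^ (p ℕ.^ d) - 𝕏) ≈ 0#
    factor≉0 {e} e*obstruction≉0 d 0<d d≤n eq = e*obstruction≉0 (go n d≤n)
      where
      go : ∀ k → d ℕ.≤ k → e * obstruction k ≈ 0#
      go zero    d≤0 = contradiction 0<d (ℕ.≤⇒≯ d≤0)
      go (suc k) d≤1+k with ℕ.m≤n⇒m<n∨m≡n d≤1+k
      ... | inj₂ ≡.refl = trans (sym (*-assoc e _ _)) (trans (*-congʳ eq) (zeroˡ _))
      ... | inj₁ d<1+k  = trans (*-congˡ (*-comm _ _)) (trans (sym (*-assoc e _ _))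
              (trans (*-congʳ (go k (ℕ.m<1+n⇒m≤n d<1+k))) (zeroˡ _)))

    finiteField : FiniteField q
    finiteField with minimalIdempotent
    ... | e , e≉0 , e*e₀≈e , e-minimal =
      ResidueField.finiteField algebra (≃0? K-0?) {n = n} prime algebra-char a^q≈a m 1+m≡q
        e e≉0 e-minimal 𝕏 (factor≉0 (e*obstruction≉0 e≉0 e*e₀≈e))

finiteFieldOfOrder : ∀ {p n} → Prime p → 1 ℕ.≤ n → FiniteField (p ℕ.^ n)
finiteFieldOfOrder {p} {suc n} pp _ = SplittingField.finiteField
  Zp.ℤ/p pp Zp.char Zp.1≉0 Zp.0? Zp.residue m n (ℕ.suc-pred (p ℕ.^ suc n))
  where
  module Zp = IntegersModulo p pp
  instance
    _ = prime⇒nonZero pp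
    _ = ℕ.m^n≢0 p (suc n)

  m = ℕ.pred (p ℕ.^ suc n)

  instance
    _ : NonZero m
    _ = ℕ.>-nonZero (ℕ.s<s⁻¹ (≡.subst (1 ℕ.<_) (≡.sym (ℕ.suc-pred (p ℕ.^ suc n)))
          (ℕ.≤-trans (ℕ.nonTrivial⇒n>1 p {{prime⇒nonTrivial pp}}) (ℕ.m≤m*n p (p ℕ.^ n) {{ℕ.m^n≢0 p n}}))))

-- Counting in subsets of Fin v

module _ {a} {A : Set a} where

  allPairs-lookup-injective : ∀ {ℓ} {_~_ : A → A → Set ℓ} → (∀ {x y} → x ~ y → y ~ x) →
    ∀ {xs} → AllPairs (λ x y → ¬ x ~ y) xs → ∀ {i j} → List.lookup xs i ~ List.lookup xs j → i ≡ j
  allPairs-lookup-injective ~-sym (x≁ ∷ _) {zero}  {zero}  _   = ≡.refl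
  allPairs-lookup-injective ~-sym (x≁ ∷ _) {zero}  {suc j} x~y = contradiction x~y (All.lookup x≁ (∈.∈-lookup j))
  allPairs-lookup-injective ~-sym (x≁ ∷ _) {suc i} {zero}  y~x = contradiction (~-sym y~x) (All.lookup x≁ (∈.∈-lookup i))
  allPairs-lookup-injective ~-sym (_ ∷ un) {suc i} {suc j} x~y = ≡.cong suc (allPairs-lookup-injective ~-sym un x~y)

  allPairs-map : ∀ {b p ℓ ℓ′} {B : Set b} {P : A → Set p} {R : A → A → Set ℓ} {S : B → B → Set ℓ′} {f : A → B} →
                 (∀ {x y} → P x → P y → R x y → S (f x) (f y)) →
                 ∀ {xs} → All P xs → AllPairs R xs → AllPairs S (List.map f xs)
  allPairs-map pres []         []         = []
  allPairs-map pres (Px ∷ Pxs) (Rx ∷ Rxs) =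
    All.map⁺ (All.map (λ (Py , Rxy) → pres Px Py Rxy) (All.zip (Pxs , Rx))) ∷ allPairs-map pres Pxs Rxs

  -- Pigeonhole with labels given by a relation: only the listed entries need a label, and a label
  -- must determine its entry.
  length≤-by-labels : ∀ {ℓ k} (R : A → Fin k → Set ℓ) → (∀ {x y l} → R x l → R y l → x ≡ y) →
                      ∀ {xs} → AllPairs _≢_ xs → All (λ x → ∃ (R x)) xs → length xs ℕ.≤ k
  length≤-by-labels R functional {xs} unique labels =
    Fin.injective⇒≤ {f = λ i → proj₁ (label i)} λ {i} {j} eq →
      allPairs-lookup-injective ≡.sym unique
        (functional (proj₂ (label i)) (≡.subst (R _) (≡.sym eq) (proj₂ (label j))))
    where
    label : ∀ i → ∃ (R (List.lookup xs i))
    label i = All.lookup labels (∈.∈-lookup i)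

  length-filter-∁ : ∀ {p} {P : A → Set p} (P? : Decidable P) xs →
                    length xs ≡ length (List.filter P? xs) ℕ.+ length (List.filter (∁? P?) xs)
  length-filter-∁ P? [] = ≡.refl
  length-filter-∁ P? (x ∷ xs) with P? x
  ... | yes _ = ≡.cong suc (length-filter-∁ P? xs)
  ... | no  _ = ≡.trans (≡.cong suc (length-filter-∁ P? xs)) (≡.sym (ℕ.+-suc _ _))

  -- The entries covered by the first s number at most k, and the others are covered by the rest of
  -- the list.
  length≤-by-cover : ∀ {b ℓ ℓ′ k} {B : Set b} {_#_ : A → A → Set ℓ′} {P : A → B → Set ℓ} (P? : ∀ x s → Dec (P x s)) →
    (∀ s {xs} → AllPairs _#_ xs → All (λ x → P x s) xs → length xs ℕ.≤ k) →
    ∀ ss {xs} → AllPairs _#_ xs → All (λ x → Any (P x) ss) xs → length xs ℕ.≤ length ss ℕ.* k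
  length≤-by-cover P? bound [] {[]}    unique cover    = z≤n
  length≤-by-cover P? bound [] {_ ∷ _} unique (() ∷ _)
  length≤-by-cover {k = k} {P = P} P? bound (s ∷ ss) {xs} unique cover = begin
    length xs
      ≡⟨ length-filter-∁ (λ x → P? x s) xs ⟩
    length (List.filter (λ x → P? x s) xs) ℕ.+ length (List.filter (∁? (λ x → P? x s)) xs)
      ≤⟨ ℕ.+-mono-≤
           (bound s (AllPairs.filter⁺ (λ x → P? x s) unique) (All.all-filter (λ x → P? x s) xs))
           (length≤-by-cover P? bound ss (AllPairs.filter⁺ (∁? (λ x → P? x s)) unique)
             (All.map rest (All.zip (All.all-filter (∁? (λ x → P? x s)) xs , All.filter⁺ (∁? (λ x → P? x s)) cover)))) ⟩
    k ℕ.+ length ss ℕ.* k ∎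
    where
    open ℕ.≤-Reasoning
    rest : ∀ {x} → (¬ P x s) × Any (P x) (s ∷ ss) → Any (P x) ss
    rest (¬Pxs , here Pxs)  = contradiction Pxs ¬Pxs
    rest (_    , there Pxss) = Pxss

members : ∀ {n} → Subset n → List (Fin n)
members []            = []
members (outside ∷ T) = List.map suc (members T)
members (inside ∷ T)  = zero ∷ List.map suc (members T)

length-members : ∀ {n} (T : Subset n) → length (members T) ≡ ∣ T ∣
length-members []            = ≡.refl
length-members (outside ∷ T) = ≡.trans (List.length-map suc (members T)) (length-members T)
length-members (inside ∷ T)  = ≡.cong suc (≡.trans (List.length-map suc (members T)) (length-members T))

members-∈ : ∀ {n} (T : Subset n) → All (_∈ T) (members T)
members-∈ []            = []
members-∈ (outside ∷ T) = All.map⁺ (All.map there (members-∈ T))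
members-∈ (inside ∷ T)  = here ∷ All.map⁺ (All.map there (members-∈ T))

∈-members : ∀ {n} {T : Subset n} {x} → x ∈ T → x ∈ₗ members T
∈-members {T = inside ∷ T}  here        = here ≡.refl
∈-members {T = inside ∷ T}  (there x∈T) = there (∈.∈-map⁺ suc (∈-members x∈T))
∈-members {T = outside ∷ T} (there x∈T) = ∈.∈-map⁺ suc (∈-members x∈T)

members-unique : ∀ {n} (T : Subset n) → AllPairs _≢_ (members T)
members-unique []            = []
members-unique (outside ∷ T) = AllPairs.map⁺ (AllPairs.map (λ x≢y → x≢y ∘ Fin.suc-injective) (members-unique T))
members-unique (inside ∷ T)  = All.map⁺ (All.universal (λ _ ()) (members T)) ∷
  AllPairs.map⁺ (AllPairs.map (λ x≢y → x≢y ∘ Fin.suc-injective) (members-unique T))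

image : ∀ {k v} → (Fin k → Fin v) → Subset v
image f = Vec.tabulate λ x → does (Fin.any? λ i → f i Fin.≟ x)

∈-image⁺ : ∀ {k v} (f : Fin k → Fin v) i → f i ∈ image f
∈-image⁺ f i = Vec.lookup⇒[]= (f i) (image f) (≡.trans (Vec.lookup∘tabulate _ (f i))
  (dec-true (Fin.any? λ j → f j Fin.≟ f i) (i , ≡.refl)))

∈-image⁻ : ∀ {k v} (f : Fin k → Fin v) {x} → x ∈ image f → ∃ λ i → f i ≡ x
∈-image⁻ f {x} x∈ with Fin.any? (λ i → f i Fin.≟ x) | ≡.trans (≡.sym (Vec.lookup∘tabulate _ x)) (Vec.[]=⇒lookup x∈)
... | yes found | _  = found
... | no _      | ()

∣image∣ : ∀ {k v} {f : Fin k → Fin v} → Injective _≡_ _≡_ f → ∣ image f ∣ ≡ k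
∣image∣ {k} {f = f} f-injective = ≡.trans (≡.sym (length-members (image f))) (ℕ.≤-antisym
  (length≤-by-labels (λ x i → f i ≡ x) (λ { ≡.refl ≡.refl → ≡.refl }) (members-unique (image f))
    (All.map (∈-image⁻ f) (members-∈ (image f))))
  (Fin.injective⇒≤ {f = λ i → Any.index (∈-members (∈-image⁺ f i))} λ {i} {j} eq → f-injective
    (≡.trans (Any.lookup-index (∈-members (∈-image⁺ f i)))
      (≡.trans (≡.cong (List.lookup (members (image f))) eq)
        (≡.sym (Any.lookup-index (∈-members (∈-image⁺ f j))))))))

-- `On i` is a condition met by all points of block i; common points are easier to bound through it
-- than through the image. Distinctness and the packing property both follow because more than c
-- common points force equal indices.
packing : ∀ {v k c b} (block : Fin b → Fin k → Fin v) (On : Fin b → Fin v → Set) →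
          (∀ i → Injective _≡_ _≡_ (block i)) → (∀ i l → On i (block i l)) → c ℕ.< k →
          (∀ {i j} → i ≢ j → ∀ {xs} → AllPairs _≢_ xs → All (On i) xs → All (On j) xs → length xs ℕ.≤ c) →
          HasPacking v k (suc c) b
packing {v} {k} {c} {b} block On injective on c<k common = B , record
  -- Equal blocks share a whole block, that is k > c points.
  { distinct  = λ {i} {j} Bᵢ≡Bⱼ → equal (Vec.lookup B i) (≡.subst (c ℕ.<_) (≡.sym (size i)) c<k)
                                    i j id (λ {x} → ≡.subst (x ∈_) Bᵢ≡Bⱼ)
  ; blockSize = size
  ; atMostOne = λ T ∣T∣≡1+c → equal T (ℕ.≤-reflexive (≡.sym ∣T∣≡1+c))
  }
  where
  B = Vec.tabulate (image ∘ block)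

  size : ∀ i → ∣ Vec.lookup B i ∣ ≡ k
  size i = ≡.trans (≡.cong ∣_∣ (Vec.lookup∘tabulate (image ∘ block) i)) (∣image∣ (injective i))

  ∈B⇒On : ∀ i {x} → x ∈ Vec.lookup B i → On i x
  ∈B⇒On i x∈ with ∈-image⁻ (block i) (≡.subst (_ ∈_) (Vec.lookup∘tabulate (image ∘ block) i) x∈)
  ... | l , ≡.refl = on i l

  equal : ∀ T → c ℕ.< ∣ T ∣ → ∀ i j → T ⊆ Vec.lookup B i → T ⊆ Vec.lookup B j → i ≡ j
  equal T c<∣T∣ i j T⊆Bᵢ T⊆Bⱼ with i Fin.≟ j
  ... | yes i≡j = i≡j
  ... | no  i≢j = contradiction
    (≡.subst (ℕ._≤ c) (length-members T) (common i≢j (members-unique T)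
      (All.map (∈B⇒On i ∘ T⊆Bᵢ) (members-∈ T)) (All.map (∈B⇒On j ∘ T⊆Bⱼ) (members-∈ T))))
    (ℕ.<⇒≱ c<∣T∣)

-- Lines and bundles

module Geometry (r c : ℕ) .{{r≢0 : NonZero r}} .{{c≢0 : NonZero c}} (𝔽 : FiniteField (suc (r ℕ.* c))) where

  open FiniteField 𝔽
  open Exp commutativeSemiring using (^-congˡ; ^-assocʳ; ^-distrib-*)
  open RingProperties ring using (-‿distribˡ-*; -‿distribʳ-*)
  open AbelianGroupProperties +-abelianGroup using (x∙y⁻¹≈ε⇒x≈y)
  open SemiringSolver commutativeSemiring using (solve; _:=_; _:+_; _:*_)
  open import Relation.Binary.Reasoning.Setoid setoid

  private
    instance
      _ : NonZero (r ℕ.* c)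
      _ = ℕ.m*n≢0 r c

  -- At 0 this is a junk value, namely 0 ^ (q − 2).
  infix 8 _⁻¹
  _⁻¹ : Carrier → Carrier
  x ⁻¹ = x ^ ℕ.pred (r ℕ.* c)

  ⁻¹-inverseʳ : ∀ {x} → ¬ x ≈ 0# → x * x ⁻¹ ≈ 1#
  ⁻¹-inverseʳ {x} x≉0 = trans (reflexive (≡.cong (x ^_) (ℕ.suc-pred (r ℕ.* c)))) (x^[q-1]≈1 x≉0)

  *-cancelˡ : ∀ {x y z} → ¬ x ≈ 0# → x * y ≈ x * z → y ≈ z
  *-cancelˡ {x} {y} {z} x≉0 xy≈xz = trans (sym (cancel y)) (trans (*-congˡ xy≈xz) (cancel z))
    where
    cancel : ∀ t → x ⁻¹ * (x * t) ≈ t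
    cancel t = begin
      x ⁻¹ * (x * t)   ≈⟨ solve 3 (λ i x t → i :* (x :* t) := x :* i :* t) refl (x ⁻¹) x t ⟩
      x * x ⁻¹ * t     ≈⟨ *-congʳ (⁻¹-inverseʳ x≉0) ⟩
      1# * t           ≈⟨ *-identityˡ t ⟩
      t                ∎

  noZeroDivisors : ∀ {x y} → x * y ≈ 0# → ¬ x ≈ 0# → y ≈ 0#
  noZeroDivisors {x} xy≈0 x≉0 = *-cancelˡ x≉0 (trans xy≈0 (sym (zeroʳ x)))

  *-≉0 : ∀ {x y} → ¬ x ≈ 0# → ¬ y ≈ 0# → ¬ x * y ≈ 0#
  *-≉0 x≉0 y≉0 xy≈0 = y≉0 (noZeroDivisors xy≈0 x≉0)

  open PolynomialRoots commutativeRing noZeroDivisors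

  0^c≈0 : 0# ^ c ≈ 0#
  0^c≈0 = ≡.subst (λ k → 0# ^ k ≈ 0#) (ℕ.suc-pred c) (zeroˡ _)

  ^c≉0⇒≉0 : ∀ {x} → ¬ x ^ c ≈ 0# → ¬ x ≈ 0#
  ^c≉0⇒≉0 xᶜ≉0 x≈0 = xᶜ≉0 (trans (^-congˡ c x≈0) 0^c≈0)

  1≉0-from : ∀ {x} → x ≈ 1# → ¬ x ≈ 0#
  1≉0-from x≈1 x≈0 = 1≉0 (trans (sym x≈1) x≈0)

  ^-≉0 : ∀ {x} → ¬ x ≈ 0# → ∀ k → ¬ x ^ k ≈ 0#
  ^-≉0 x≉0 zero    = 1≉0
  ^-≉0 x≉0 (suc k) = *-≉0 x≉0 (^-≉0 x≉0 k)

  1^k≈1 : ∀ k → 1# ^ k ≈ 1#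
  1^k≈1 zero    = refl
  1^k≈1 (suc k) = trans (*-identityˡ _) (1^k≈1 k)

  length≤-by-power : ∀ k .{{_ : NonZero k}} a {xs} → AllPairs (λ x y → ¬ x ≈ y) xs →
                     All (λ x → x ^ k ≈ a) xs → length xs ℕ.≤ k
  length≤-by-power (suc k) a unique powers = roots≤degree
    (+-const-hasDegree (- a) (^-hasDegree 1≉0 (suc k))) unique
    (All.map (λ xᵏ≈a → trans (+-congʳ xᵏ≈a) (-‿inverseʳ a)) powers)

  unit : Fin (r ℕ.* c) → Carrier
  unit i = element (punchIn (proj₁ (element-surjective 0#)) i)

  unit≉0 : ∀ i → ¬ unit i ≈ 0#
  unit≉0 i uᵢ≈0 = Fin.punchInᵢ≢i _ i (element-injective (trans uᵢ≈0 (sym (proj₂ (element-surjective 0#)))))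

  unit-injective : ∀ {i j} → unit i ≈ unit j → i ≡ j
  unit-injective eq = Fin.punchIn-injective _ _ _ (element-injective eq)

  unit-surjective : ∀ {x} → ¬ x ≈ 0# → ∃ λ i → unit i ≈ x
  unit-surjective {x} x≉0 with i , eᵢ≈x ← element-surjective x =
    punchOut i₀≢i , trans (reflexive (≡.cong element (Fin.punchIn-punchOut i₀≢i))) eᵢ≈x
    where
    i₀≢i : proj₁ (element-surjective 0#) ≢ i
    i₀≢i ≡.refl = x≉0 (trans (sym eᵢ≈x) (proj₂ (element-surjective 0#)))

  -- x and y are in the same coset of the c-th roots of unity.
  _∼_ : Carrier → Carrier → Set
  x ∼ y = x ^ c ≈ y ^ c

  private
    ∼-decSetoid : DecSetoid 0ℓ 0ℓ
    ∼-decSetoid = record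
      { _≈_ = _∼_
      ; isDecEquivalence = record
        { isEquivalence = record { refl = refl ; sym = sym ; trans = trans }
        ; _≟_ = λ x y → (x ^ c) ≟ (y ^ c) } }

    _∼?_ = DecSetoid._≟_ ∼-decSetoid

    units : List Carrier
    units = List.tabulate unit

    representatives : List Carrier
    representatives = List.deduplicate _∼?_ units

    representatives-unique : AllPairs (λ x y → ¬ x ∼ y) representatives
    representatives-unique = deduplicate-! ∼-decSetoid units

    representatives≉0 : All (λ x → ¬ x ≈ 0#) representatives
    representatives≉0 = All.deduplicate⁺ _∼?_ (All.tabulate⁺ unit≉0)

    representatives-cover : ∀ {x} → ¬ x ≈ 0# → Any (x ∼_) representatives
    representatives-cover {x} x≉0 = let i , uᵢ≈x = unit-surjective x≉0 in
      Any.deduplicate⁺ _∼?_ (λ s∼t x∼s → trans x∼s (sym s∼t))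
        (Any.tabulate⁺ {f = unit} i (sym (^-congˡ c uᵢ≈x)))

    -- At most r, since the c-th powers of the representatives are distinct roots of Y^r = 1; at
    -- least r, since each coset has at most c elements and together they cover r c units.
    length-representatives : length representatives ≡ r
    length-representatives = ℕ.≤-antisym
      (≡.subst (ℕ._≤ r) (List.length-map (_^ c) representatives)
        (length≤-by-power r 1# (AllPairs.map⁺ representatives-unique)
          (All.map⁺ (All.map (λ {x} x≉0 → trans (^-assocʳ x c r)
            (trans (reflexive (≡.cong (x ^_) (ℕ.*-comm c r))) (x^[q-1]≈1 x≉0))) representatives≉0))))
      (ℕ.*-cancelʳ-≤ r (length representatives) c (≡.subst (ℕ._≤ length representatives ℕ.* c) (List.length-tabulate unit)
        (length≤-by-cover (λ x s → x ∼? s) (λ s → length≤-by-power c (s ^ c)) representatives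
          (AllPairs.tabulate⁺ (λ i≢j uᵢ≈uⱼ → i≢j (unit-injective uᵢ≈uⱼ)))
          (All.tabulate⁺ {f = unit} (λ i → representatives-cover (unit≉0 i))))))

    Transversal : ℕ → Set
    Transversal n = Σ (Fin n → Carrier) λ s →
      (∀ i → ¬ s i ≈ 0#) × (∀ {i j} → s i ∼ s j → i ≡ j) × (∀ {x} → ¬ x ≈ 0# → ∃ λ i → x ∼ s i)

  abstract
    transversal : Transversal r
    transversal = ≡.subst Transversal length-representatives
      ( List.lookup representatives
      , (λ i → All.lookup representatives≉0 (∈.∈-lookup i))
      , (λ {i} {j} → allPairs-lookup-injective sym representatives-unique)
      , (λ x≉0 → Any.index (representatives-cover x≉0) , Any.lookup-index (representatives-cover x≉0)))

  scale : Fin r → Carrier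
  scale = proj₁ transversal

  scale≉0 : ∀ i → ¬ scale i ≈ 0#
  scale≉0 = proj₁ (proj₂ transversal)

  scale-injective : ∀ {i j} → scale i ∼ scale j → i ≡ j
  scale-injective = proj₁ (proj₂ (proj₂ transversal))

  scale-surjective : ∀ {x} → ¬ x ≈ 0# → ∃ λ i → x ∼ scale i
  scale-surjective = proj₂ (proj₂ (proj₂ transversal))

  -- The q + 1 points of the projective line over the field of order q = r c + 1, normalised as (1,
  -- 0) and (t, 1).
  Direction : Set
  Direction = Fin (suc (suc (r ℕ.* c)))

  X Y : Direction → Carrier
  X zero    = 1#
  X (suc i) = element i
  Y zero    = 0#
  Y (suc i) = 1#

  direction-injective : ∀ {d d′} → X d * Y d′ ≈ Y d * X d′ → d ≡ d′
  direction-injective {zero}  {zero}  eq = ≡.refl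
  direction-injective {zero}  {suc j} eq = contradiction (trans (sym (*-identityʳ 1#)) (trans eq (zeroˡ _))) 1≉0
  direction-injective {suc i} {zero}  eq =
    contradiction (trans (sym (*-identityʳ 1#)) (trans (sym eq) (zeroʳ _))) 1≉0
  direction-injective {suc i} {suc j} eq =
    ≡.cong suc (element-injective (trans (sym (*-identityʳ _)) (trans eq (*-identityˡ _))))

  -- Eliminating the coordinate other than a non-zero one of (u, v) makes the determinant of the two
  -- directions vanish.
  orthogonal-unique : ∀ {u v d d′} → ¬ (u ≈ 0# × v ≈ 0#) →
                      u * X d + v * Y d ≈ 0# → u * X d′ + v * Y d′ ≈ 0# → d ≡ d′
  orthogonal-unique {u} {v} {d} {d′} uv≉0 u⊥d u⊥d′ = direction-injective proportional
    where
    eliminate : ∀ {a b a′ b′ x y} → x * a + y * b ≈ 0# → x * a′ + y * b′ ≈ 0# → x * (a * b′) ≈ x * (b * a′)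
    eliminate {a} {b} {a′} {b′} {x} {y} e e′ = begin
      x * (a * b′)                                    ≈⟨ +-identityʳ _ ⟨
      x * (a * b′) + 0#                               ≈⟨ +-congˡ (trans (*-congˡ e′) (zeroʳ b)) ⟨
      x * (a * b′) + b * (x * a′ + y * b′)            ≈⟨ solve 6 (λ a b a′ b′ x y →
          x :* (a :* b′) :+ b :* (x :* a′ :+ y :* b′) := b′ :* (x :* a :+ y :* b) :+ x :* (b :* a′))
          refl a b a′ b′ x y ⟩
      b′ * (x * a + y * b) + x * (b * a′)             ≈⟨ +-congʳ (trans (*-congˡ e) (zeroʳ b′)) ⟩
      0# + x * (b * a′)                               ≈⟨ +-identityˡ _ ⟩
      x * (b * a′)                                    ∎

    proportional : X d * Y d′ ≈ Y d * X d′
    proportional with u ≟ 0# | v ≟ 0#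
    ... | no u≉0  | _       = *-cancelˡ u≉0 (eliminate u⊥d u⊥d′)
    ... | yes _   | no v≉0  = sym (*-cancelˡ v≉0
      (eliminate (trans (+-comm _ _) u⊥d) (trans (+-comm _ _) u⊥d′)))
    ... | yes u≈0 | yes v≈0 = contradiction (u≈0 , v≈0) uv≉0

  direction≉0 : ∀ d → ¬ (X d ≈ 0# × Y d ≈ 0#)
  direction≉0 zero    (1≈0 , _) = 1≉0 1≈0
  direction≉0 (suc _) (_ , 1≈0) = 1≉0 1≈0

  -- (0, 1) is perpendicular to (1, 0); for (w, 1) it is (-1/w, 1), or (1, 0) if w = 0.
  orthogonal : ∀ w → ∃ λ d → X w * X d + Y w * Y d ≈ 0#
  orthogonal zero = let i , eᵢ≈0 = element-surjective 0# in
    suc i , trans (+-cong (trans (*-identityˡ _) eᵢ≈0) (zeroˡ _)) (+-identityʳ 0#)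
  orthogonal (suc w) with element w ≟ 0#
  ... | yes w≈0 = zero , trans (+-cong (trans (*-identityʳ _) w≈0) (zeroʳ _)) (+-identityʳ 0#)
  ... | no  w≉0 = let i , eᵢ≈ = element-surjective (- (element w ⁻¹)) in suc i , (begin
    element w * element i + 1# * 1#              ≈⟨ +-cong (*-congˡ eᵢ≈) (*-identityʳ 1#) ⟩
    element w * - (element w ⁻¹) + 1#            ≈⟨ +-congʳ (-‿distribʳ-* _ _) ⟨
    - (element w * element w ⁻¹) + 1#            ≈⟨ +-congʳ (-‿cong (⁻¹-inverseʳ w≉0)) ⟩
    - 1# + 1#                                    ≈⟨ -‿inverseˡ 1# ⟩
    0#                                           ∎)

  -- (q + 1) r, which is (q^2 - 1)/c because q - 1 = r c.
  N : ℕ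
  N = suc (suc (r ℕ.* c)) ℕ.* r

  -- zero is the origin, and suc (combine d s) is the class of scale s · (X d , Y d) modulo the
  -- c-th roots of unity; non-zero linear forms up to these roots are indexed by Fin N likewise.
  Point : Set
  Point = Fin (suc N)

  direction : Fin N → Direction
  direction x = proj₁ (remQuot r x)

  size : Fin N → Carrier
  size x = scale (proj₂ (remQuot {suc (suc (r ℕ.* c))} r x))

  size≉0 : ∀ x → ¬ size x ≈ 0#
  size≉0 x = scale≉0 _

  vector-injective : ∀ {x y} → direction x ≡ direction y → size x ∼ size y → x ≡ y
  vector-injective {x} {y} d≡ s∼ = ≡.trans (≡.sym (Fin.combine-remQuot r x)) (≡.trans
    (≡.cong₂ combine d≡ (scale-injective s∼)) (Fin.combine-remQuot r y))

  form : Fin N → Direction → Carrier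
  form j d = size j * X (direction j) * X d + size j * Y (direction j) * Y d

  form≈ : ∀ j d → form j d ≈ size j * (X (direction j) * X d + Y (direction j) * Y d)
  form≈ j d = solve 5 (λ s a b x y → s :* a :* x :+ s :* b :* y := s :* (a :* x :+ b :* y)) refl _ _ _ _ _

  -- The class of a vector lies on the line block j when the form j sends the vector to a c-th root
  -- of unity, that is, when some multiple of the vector by such a root lies on the line form j = 1.
  OnLine : Fin N → Point → Set
  OnLine j zero    = ⊥
  OnLine j (suc x) = (size x * form j (direction x)) ^ c ≈ 1#

  -- Group k consists of the c consecutive directions from number k c on.
  slot : Fin (suc (suc (r ℕ.* c)) ℕ./ c) → Fin c → Direction
  slot k l = inject≤ (combine k l) (ℕ.m/n*n≤m _ c)

  slot-injective : ∀ {k k′ l l′} → slot k l ≡ slot k′ l′ → k ≡ k′ × l ≡ l′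
  slot-injective {k} {k′} {l} {l′} eq = Fin.combine-injective k l k′ l′
    (Fin.inject≤-injective (ℕ.m/n*n≤m _ c) (ℕ.m/n*n≤m _ c) _ _ eq)

  OnBundle : Fin (suc (suc (r ℕ.* c)) ℕ./ c) → Point → Set
  OnBundle k zero    = ⊤
  OnBundle k (suc x) = ∃ λ l → direction x ≡ slot k l

  -- Common points of two blocks

  OnLine⇒form≉0 : ∀ {j x} → OnLine j (suc x) → ¬ form j (direction x) ≈ 0#
  OnLine⇒form≉0 on f≈0 = ^c≉0⇒≉0 (1≉0-from on) (trans (*-congˡ f≈0) (zeroʳ _))

  -- The value t of the form on the direction is non-zero, so (s t)^c = 1 determines the class of
  -- the size s.
  OnLine-same-direction : ∀ {j x y} → OnLine j (suc x) → OnLine j (suc y) → direction x ≡ direction y → x ≡ y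
  OnLine-same-direction {j} {x} {y} on-x on-y d≡ = vector-injective d≡
    (*-cancelˡ (^-≉0 (OnLine⇒form≉0 {j} {x} on-x) c) (begin
      t ^ c * size x ^ c                      ≈⟨ ^-distrib-* t (size x) c ⟨
      (t * size x) ^ c                        ≈⟨ ^-congˡ c (*-comm t (size x)) ⟩
      (size x * t) ^ c                        ≈⟨ on-x ⟩
      1#                                      ≈⟨ on-y ⟨
      (size y * form j (direction y)) ^ c     ≡⟨ ≡.cong (λ d → (size y * form j d) ^ c) d≡ ⟨
      (size y * t) ^ c                        ≈⟨ ^-congˡ c (*-comm (size y) t) ⟩
      (t * size y) ^ c                        ≈⟨ ^-distrib-* t (size y) c ⟩
      t ^ c * size y ^ c                      ∎))
    where t = form j (direction x)

  module _ {i j : Fin N} (i≢j : i ≢ j) where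

    -- At a common point both forms, multiplied by the same size, are c-th roots of unity, so their
    -- ratio is one too. It labels common points by at most c values; the origin gets a default.
    ratio : Point → Carrier
    ratio zero    = 0#
    ratio (suc x) = form j (direction x) * form i (direction x) ⁻¹

    ratio*form : ∀ {x} → OnLine i (suc x) → ratio (suc x) * form i (direction x) ≈ form j (direction x)
    ratio*form {x} on-i = begin
      t′ * t ⁻¹ * t       ≈⟨ *-assoc t′ _ t ⟩
      t′ * (t ⁻¹ * t)     ≈⟨ *-congˡ (trans (*-comm _ t) (⁻¹-inverseʳ (OnLine⇒form≉0 {i} {x} on-i))) ⟩
      t′ * 1#             ≈⟨ *-identityʳ t′ ⟩
      t′                  ∎
      where
      t  = form i (direction x)
      t′ = form j (direction x)

    ratio^c≈1 : ∀ {x} → OnLine i x × OnLine j x → ratio x ^ c ≈ 1#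
    ratio^c≈1 {suc x} (on-i , on-j) = begin
      ρ ^ c                            ≈⟨ *-identityʳ _ ⟨
      ρ ^ c * 1#                       ≈⟨ *-congˡ on-i ⟨
      ρ ^ c * (s * t) ^ c              ≈⟨ ^-distrib-* ρ (s * t) c ⟨
      (ρ * (s * t)) ^ c                ≈⟨ ^-congˡ c (solve 3 (λ ρ s t → ρ :* (s :* t) := s :* (ρ :* t)) refl ρ s t) ⟩
      (s * (ρ * t)) ^ c                ≈⟨ ^-congˡ c (*-congˡ (ratio*form {x} on-i)) ⟩
      (s * form j (direction x)) ^ c   ≈⟨ on-j ⟩
      1#                               ∎
      where
      ρ = ratio (suc x)
      s = size x
      t = form i (direction x)

    -- Forms that differ by a c-th root of unity have the same index: proportionality forces equal
    -- directions, and a non-zero coordinate then compares the sizes.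
    forms-not-proportional : ∀ {ρ} → ρ ^ c ≈ 1# → ¬ (size j * X (direction j) ≈ ρ * (size i * X (direction i)) ×
                                                    size j * Y (direction j) ≈ ρ * (size i * Y (direction i)))
    forms-not-proportional {ρ} ρᶜ≈1 (x-eq , y-eq) = i≢j (vector-injective (≡.sym d≡) (begin
      size i ^ c             ≈⟨ *-identityˡ _ ⟨
      1# * size i ^ c        ≈⟨ *-congʳ ρᶜ≈1 ⟨
      ρ ^ c * size i ^ c     ≈⟨ ^-distrib-* ρ (size i) c ⟨
      (ρ * size i) ^ c       ≈⟨ ^-congˡ c size-eq ⟨
      size j ^ c             ∎))
      where
      d≡ : direction j ≡ direction i
      d≡ = direction-injective (*-cancelˡ (*-≉0 (size≉0 j) (size≉0 i)) (begin
        size j * size i * (X (direction j) * Y (direction i))     ≈⟨ swap _ _ _ _ ⟩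
        size j * X (direction j) * (size i * Y (direction i))     ≈⟨ *-congʳ x-eq ⟩
        ρ * (size i * X (direction i)) * (size i * Y (direction i))
          ≈⟨ solve 3 (λ ρ a b → ρ :* a :* b := ρ :* b :* a) refl ρ _ _ ⟩
        ρ * (size i * Y (direction i)) * (size i * X (direction i)) ≈⟨ *-congʳ y-eq ⟨
        size j * Y (direction j) * (size i * X (direction i))     ≈⟨ swap _ _ _ _ ⟨
        size j * size i * (Y (direction j) * X (direction i))     ∎))
        where
        swap : ∀ a b x y → a * b * (x * y) ≈ a * x * (b * y)
        swap = solve 4 (λ a b x y → a :* b :* (x :* y) := a :* x :* (b :* y)) refl

      cancel : ∀ {z} → ¬ z ≈ 0# → size j * z ≈ ρ * (size i * z) → size j ≈ ρ * size i
      cancel {z} z≉0 eq = *-cancelˡ z≉0 (trans (*-comm z _) (trans eq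
        (solve 3 (λ ρ s z → ρ :* (s :* z) := z :* (ρ :* s)) refl ρ (size i) z)))

      size-eq : size j ≈ ρ * size i
      size-eq with X (direction i) ≟ 0# | Y (direction i) ≟ 0#
      ... | no x≉0  | _       = cancel x≉0 (≡.subst (λ d → size j * X d ≈ ρ * (size i * X (direction i))) d≡ x-eq)
      ... | yes _   | no y≉0  = cancel y≉0 (≡.subst (λ d → size j * Y d ≈ ρ * (size i * Y (direction i))) d≡ y-eq)
      ... | yes x≈0 | yes y≈0 = contradiction (x≈0 , y≈0) (direction≉0 (direction i))

    -- Two common points with the same ratio ρ both lie in the kernel of form j − ρ · form i.
    ratio-injective : ∀ {x y} → OnLine i x × OnLine j x → OnLine i y × OnLine j y → x ≢ y → ¬ ratio x ≈ ratio y
    ratio-injective {suc x} {suc y} on-x on-y x≢y ρ≈ρ′ =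
      x≢y (≡.cong suc (OnLine-same-direction {i} (proj₁ on-x) (proj₁ on-y)
        (orthogonal-unique difference≉0
          (kernel (direction x) (ratio*form {x} (proj₁ on-x)))
          (kernel (direction y) (trans (*-congʳ ρ≈ρ′) (ratio*form {y} (proj₁ on-y)))))))
      where
      ρ = ratio (suc x)
      u = size j * X (direction j) + - ρ * (size i * X (direction i))
      v = size j * Y (direction j) + - ρ * (size i * Y (direction i))

      difference≉0 : ¬ (u ≈ 0# × v ≈ 0#)
      difference≉0 (u≈0 , v≈0) = forms-not-proportional (ratio^c≈1 {suc x} on-x) (equal u≈0 , equal v≈0)
        where
        equal : ∀ {a b} → a + - ρ * b ≈ 0# → a ≈ ρ * b
        equal eq = x∙y⁻¹≈ε⇒x≈y _ _ (trans (+-congˡ (-‿distribˡ-* ρ _)) eq)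

      kernel : ∀ d → ρ * form i d ≈ form j d → u * X d + v * Y d ≈ 0#
      kernel d eq = begin
        u * X d + v * Y d                ≈⟨ solve 7 (λ n a b a′ b′ x y →
            (a′ :+ n :* a) :* x :+ (b′ :+ n :* b) :* y := (a′ :* x :+ b′ :* y) :+ n :* (a :* x :+ b :* y))
            refl (- ρ) _ _ _ _ (X d) (Y d) ⟩
        form j d + - ρ * form i d        ≈⟨ +-congˡ (-‿distribˡ-* ρ _) ⟨
        form j d - ρ * form i d          ≈⟨ +-congˡ (-‿cong eq) ⟩
        form j d - form j d              ≈⟨ -‿inverseʳ _ ⟩
        0#                               ∎

    line∩line : ∀ {xs} → AllPairs _≢_ xs → All (OnLine i) xs → All (OnLine j) xs → length xs ℕ.≤ c
    line∩line {xs} unique on-i on-j = ≡.subst (ℕ._≤ c) (List.length-map ratio xs)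
      (length≤-by-power c 1# (allPairs-map (λ {x} {y} → ratio-injective {x} {y}) on-both unique)
        (All.map⁺ (All.map (λ {x} → ratio^c≈1 {x}) on-both)))
      where on-both = All.zip (on-i , on-j)

  -- The label of a common point is its direction's position among the c directions of the bundle;
  -- the line block has one point per direction.
  line∩bundle : ∀ j k {xs} → AllPairs _≢_ xs → All (OnLine j) xs → All (OnBundle k) xs → length xs ℕ.≤ c
  line∩bundle j k unique on-line on-bundle = length≤-by-labels Labelled
    (λ {x} {y} → functional {x} {y}) unique (All.map (λ {x} → label {x}) (All.zip (on-line , on-bundle)))
    where
    Labelled : Point → Fin c → Set
    Labelled zero    l = ⊥
    Labelled (suc x) l = OnLine j (suc x) × direction x ≡ slot k l

    functional : ∀ {x y l} → Labelled x l → Labelled y l → x ≡ y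
    functional {suc x} {suc y} (on-x , d≡) (on-y , d′≡) =
      ≡.cong suc (OnLine-same-direction {j} on-x on-y (≡.trans d≡ (≡.sym d′≡)))

    label : ∀ {x} → OnLine j x × OnBundle k x → ∃ (Labelled x)
    label {suc x} (on-x , l , d≡) = l , on-x , d≡

  bundle∩bundle : ∀ {k k′} → k ≢ k′ → ∀ {xs} → AllPairs _≢_ xs →
                  All (OnBundle k) xs → All (OnBundle k′) xs → length xs ℕ.≤ c
  bundle∩bundle {k} {k′} k≢k′ unique on-k on-k′ = ℕ.≤-trans
    (length≤-by-labels {k = 1} (λ x _ → x ≡ zero) (λ { ≡.refl ≡.refl → ≡.refl }) unique
      (All.map (λ on → zero , origin on) (All.zip (on-k , on-k′))))
    (ℕ.>-nonZero⁻¹ c)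
    where
    origin : ∀ {x} → OnBundle k x × OnBundle k′ x → x ≡ zero
    origin {zero}  _ = ≡.refl
    origin {suc x} ((l , d≡) , (l′ , d≡′)) =
      contradiction (proj₁ (slot-injective (≡.trans (≡.sym d≡) d≡′))) k≢k′

  -- The blocks enumerated

  kernelDirection : Fin N → Direction
  kernelDirection j = proj₁ (orthogonal (direction j))

  form≉0 : ∀ j i → ¬ form j (punchIn (kernelDirection j) i) ≈ 0#
  form≉0 j i f≈0 = Fin.punchInᵢ≢i (kernelDirection j) i (orthogonal-unique {d = punchIn (kernelDirection j) i} (direction≉0 (direction j))
    (noZeroDivisors (trans (sym (form≈ j (punchIn (kernelDirection j) i))) f≈0) (size≉0 j)) (proj₂ (orthogonal (direction j))))

  -- The kernel direction is parallel to the line, and each of the other q directions meets it once.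
  -- The scale is the class of the inverse of the form's value there.
  lineBlock : Fin N → Fin (suc (r ℕ.* c)) → Point
  lineBlock j i = suc (combine d (proj₁ (scale-surjective (^-≉0 (form≉0 j i) (ℕ.pred (r ℕ.* c))))))
    where d = punchIn (kernelDirection j) i

  lineBlock-injective : ∀ j → Injective _≡_ _≡_ (lineBlock j)
  lineBlock-injective j eq = Fin.punchIn-injective (kernelDirection j) _ _
    (Fin.combine-injectiveˡ _ _ _ _ (Fin.suc-injective eq))

  lineBlock-OnLine : ∀ j i → OnLine j (lineBlock j i)
  lineBlock-OnLine j i = ≡.subst (λ (d , l) → (scale l * form j d) ^ c ≈ 1#)
    (≡.sym (Fin.remQuot-combine d l)) (begin
      (scale l * t) ^ c        ≈⟨ ^-distrib-* (scale l) t c ⟩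
      scale l ^ c * t ^ c      ≈⟨ *-congʳ (proj₂ t⁻¹∼) ⟨
      (t ⁻¹) ^ c * t ^ c       ≈⟨ ^-distrib-* (t ⁻¹) t c ⟨
      (t ⁻¹ * t) ^ c           ≈⟨ ^-congˡ c (trans (*-comm _ t) (⁻¹-inverseʳ (form≉0 j i))) ⟩
      1# ^ c                   ≈⟨ 1^k≈1 c ⟩
      1#                       ∎)
    where
    d = punchIn (kernelDirection j) i
    t = form j d
    t⁻¹∼ = scale-surjective (^-≉0 (form≉0 j i) (ℕ.pred (r ℕ.* c)))
    l = proj₁ t⁻¹∼

  -- The origin together with r scales in each of c directions: 1 + r c = q points.
  bundleBlock : Fin (suc (suc (r ℕ.* c)) ℕ./ c) → Fin (suc (r ℕ.* c)) → Point
  bundleBlock k zero    = zero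
  bundleBlock k (suc i) = let s , l = remQuot {r} c i in suc (combine (slot k l) s)

  bundleBlock-injective : ∀ k → Injective _≡_ _≡_ (bundleBlock k)
  bundleBlock-injective k {zero}  {zero}  eq = ≡.refl
  bundleBlock-injective k {suc i} {suc j} eq = ≡.cong suc (≡.trans (≡.sym (Fin.combine-remQuot {r} c i))
    (≡.trans (≡.cong₂ combine s≡ l≡) (Fin.combine-remQuot {r} c j)))
    where
    slots≡ = Fin.combine-injective _ _ _ _ (Fin.suc-injective eq)
    s≡ = proj₂ slots≡
    l≡ = proj₂ (slot-injective {k} {k} (proj₁ slots≡))

  bundleBlock-OnBundle : ∀ k i → OnBundle k (bundleBlock k i)
  bundleBlock-OnBundle k zero    = tt
  bundleBlock-OnBundle k (suc i) = let s , l = remQuot {r} c i in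
    l , ≡.cong proj₁ (Fin.remQuot-combine (slot k l) s)

  private
    Index : Set
    Index = Fin N ⊎ Fin (suc (suc (r ℕ.* c)) ℕ./ c)

    block : Index → Fin (suc (r ℕ.* c)) → Point
    block (inj₁ j) = lineBlock j
    block (inj₂ k) = bundleBlock k

    On : Index → Point → Set
    On (inj₁ j) = OnLine j
    On (inj₂ k) = OnBundle k

    block-injective : ∀ b → Injective _≡_ _≡_ (block b)
    block-injective (inj₁ j) = lineBlock-injective j
    block-injective (inj₂ k) = bundleBlock-injective k

    block-On : ∀ b i → On b (block b i)
    block-On (inj₁ j) = lineBlock-OnLine j
    block-On (inj₂ k) = bundleBlock-OnBundle k

    common : ∀ a b → a ≢ b → ∀ {xs} → AllPairs _≢_ xs → All (On a) xs → All (On b) xs → length xs ℕ.≤ c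
    common (inj₁ i) (inj₁ j) i≢j unique on on′ = line∩line (i≢j ∘ ≡.cong inj₁) unique on on′
    common (inj₁ j) (inj₂ k) _   unique on on′ = line∩bundle j k unique on on′
    common (inj₂ k) (inj₁ j) _   unique on on′ = line∩bundle j k unique on′ on
    common (inj₂ k) (inj₂ l) k≢l unique on on′ = bundle∩bundle (k≢l ∘ ≡.cong inj₂) unique on on′

  linesAndBundles : c ℕ.≤ r ℕ.* c →
    HasPacking (suc N) (suc (r ℕ.* c)) (suc c) (N ℕ.+ suc (suc (r ℕ.* c)) ℕ./ c)
  linesAndBundles c≤rc = packing (block ∘ splitAt N) (On ∘ splitAt N)
    (block-injective ∘ splitAt N) (block-On ∘ splitAt N) (s≤s c≤rc)
    (λ {i} {j} i≢j → common (splitAt N i) (splitAt N j) λ eq → i≢j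
      (≡.trans (≡.sym (Fin.join-splitAt N _ i)) (≡.trans (≡.cong (join N _) eq) (Fin.join-splitAt N _ j))))

open import Data.Nat.Base using (ℕ; NonZero; _+_; _∸_; _^_; _≥_; _<_; _/_)
open import Data.Nat.Divisibility using (_∣_)

packingOverField : ∀ r c .{{_ : NonZero c}} → FiniteField (suc (r ℕ.* c)) → c < r ℕ.* c →
  HasPacking ((suc (r ℕ.* c) ^ 2 ∸ 1) / c + 1) (suc (r ℕ.* c)) (c + 1)
             ((suc (r ℕ.* c) ^ 2 ∸ 1) / c + (suc (r ℕ.* c) + 1) / c)
-- The case r = 0 would make c < 0.
packingOverField r@(suc _) c 𝔽 c<rc =
  ≡.subst₂ (λ v t → HasPacking v (suc m) t ((suc m ^ 2 ∸ 1) / c + (suc m + 1) / c))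
    (≡.trans (≡.cong suc N≡) (ℕ.+-comm 1 _)) (ℕ.+-comm 1 c)
    (≡.subst (HasPacking (suc N) (suc m) (suc c))
      (≡.cong₂ _+_ N≡ (≡.cong (_/ c) (ℕ.+-comm 1 (suc m))))
      (linesAndBundles (ℕ.<⇒≤ c<rc)))
  where
  open Geometry r c 𝔽
  open ≡.≡-Reasoning

  m = r ℕ.* c

  N≡ : N ≡ (suc m ^ 2 ∸ 1) / c
  N≡ = begin
    N                            ≡⟨ ℕ.m*n/n≡m N c ⟨
    (N ℕ.* c) / c                ≡⟨ ≡.cong (_/ c) (ℕ.*-assoc (suc (suc m)) r c) ⟩
    (suc (suc m) ℕ.* m) / c      ≡⟨ ≡.cong (λ k → (k ∸ 1) / c)
                                     (+-*-Solver.solve 1 (λ m → con 1 :+ (con 2 :+ m) :* m := (con 1 :+ m) :^ 2) ≡.refl m) ⟩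
    (suc m ^ 2 ∸ 1) / c          ∎
    where open +-*-Solver using (con; _:+_; _:*_; _:^_; _:=_)

mainTheorem2 : (c q : ℕ) .{{_ : NonZero c}} → IsPrimePower q → c < q ∸ 1 → c ∣ (q ∸ 1) →
    P ((q ^ 2 ∸ 1) / c + 1) q (c + 1) ≥ (q ^ 2 ∸ 1) / c + (q + 1) / c
mainTheorem2 c (suc q-1) (p , n , pp , 1≤n , q≡pⁿ) c<q-1 (ℕ.divides-refl r) =
  P-maximal (packingOverField r c (≡.subst FiniteField (≡.sym q≡pⁿ) (finiteFieldOfOrder pp 1≤n)) c<q-1)
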